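{- Let $G$ be a graph on $n$ vertices and let $\mathcal{T}_1=(B_1,l_1)$ and $\mathcal{T}_2=(B_2,l_2)$ be two labelled spanning trees of $G$ such that for each label $i$, the edge $l_1^{ -1}(i)$ and the edge $l_2^{ -1}(i)$ lie in the same 2-connected component (block) of $G$. Then $\mathcal{T}_1$ can be reconfigured to $\mathcal{T}_2$ using $O(n\log n)$ basis exchange steps.
   Context: A labelled spanning tree of an $n$-vertex graph $G$ is a pair $(B,l)$ where $B$ is the edge set of a spanning tree and $l:B\to\{1,\ldots,n-1\}$ is a bijection. A basis exchange step on $(B,l)$ removes an edge $e\in B$ and adds an edge $e'\notin B$ such that $(B\setminus\{e\})\cup\{e'\}$ is a spanning tree; $e'$ receives the label $l(e)$ and all other labels are unchanged. Two edges lie in the same block of $G$ iff they are equal or some cycle of $G$ contains both. -}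

module Defs where

open import Data.Nat using (ℕ; zero; suc; _∸_; _≤_; _*_)
open import Data.Fin using (Fin; zero; suc; inject₁; fromℕ)
open import Data.Product using (Σ; ∃; _×_; _,_)
open import Data.Sum using (_⊎_)
open import Relation.Nullary using (¬_)
open import Relation.Binary.PropositionalEquality using (_≡_; _≢_)
open import Function.Definitions using (Injective)

-- A (finite multi)graph on vertex set Fin n with edge set Fin m;
-- each edge has an (unordered) pair of endpoints, stored as an ordered pair.
record Graph (n m : ℕ) : Set where
  field
    ends : Fin m → Fin n × Fin n

open Graph public

Simple : ∀ {n m} → Graph n m → Set
Simple {n} {m} G =
  (∀ e u v → ends G e ≡ (u , v) → u ≢ v)
  × (∀ e f u v → ends G e ≡ (u , v) → (ends G f ≡ (u , v) ⊎ ends G f ≡ (v , u)) → e ≡ f)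

Joins : ∀ {n m} → Graph n m → Fin m → Fin n → Fin n → Set
Joins G e u v = ends G e ≡ (u , v) ⊎ ends G e ≡ (v , u)

record Cycle {n m : ℕ} (G : Graph n m) : Set where
  field
    k      : ℕ
    vs     : Fin (suc k) → Fin n
    es     : Fin (suc k) → Fin m
    vs-inj : Injective _≡_ _≡_ vs
    es-inj : Injective _≡_ _≡_ es
    joins  : ∀ (i : Fin k) → Joins G (es (inject₁ i)) (vs (inject₁ i)) (vs (suc i))
    closes : Joins G (es (fromℕ k)) (vs (fromℕ k)) (vs zero)

open Cycle public

OnCycle : ∀ {n m} {G : Graph n m} → Fin m → Cycle G → Set
OnCycle e C = ∃ λ i → es C i ≡ e

EdgeSet : ℕ → Set₁
EdgeSet m = Fin m → Set

data Walk {n m : ℕ} (G : Graph n m) (S : EdgeSet m) : Fin n → Fin n → Set where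
  here : ∀ {u} → Walk G S u u
  step : ∀ {u w v} (e : Fin m) → S e → Joins G e u w → Walk G S w v → Walk G S u v

Connected : ∀ {n m} → Graph n m → EdgeSet m → Set
Connected G S = ∀ u v → Walk G S u v

Acyclic : ∀ {n m} → Graph n m → EdgeSet m → Set
Acyclic G S = ¬ (Σ (Cycle G) λ C → ∀ i → S (es C i))

SpanningTree : ∀ {n m} → Graph n m → EdgeSet m → Set
SpanningTree G S = Connected G S × Acyclic G S

-- A labelling is a map from labels {1..n-1} (here Fin (n ∸ 1)) to edges;
-- its image is the edge set B, and injectivity makes l : B → labels a bijection
-- (the map below is l⁻¹).
Labelling : ℕ → ℕ → Set
Labelling n m = Fin (n ∸ 1) → Fin m

Image : ∀ {n m} → Labelling n m → EdgeSet m
Image lab e = ∃ λ i → lab i ≡ e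

IsLabelledSpanningTree : ∀ {n m} → Graph n m → Labelling n m → Set
IsLabelledSpanningTree {n} G lab = Injective _≡_ _≡_ lab × SpanningTree G (Image {n} lab)

SameBlock : ∀ {n m} → Graph n m → Fin m → Fin m → Set
SameBlock G e f = e ≡ f ⊎ Σ (Cycle G) λ C → OnCycle e C × OnCycle f C

ExchangeStep : ∀ {n m} → Graph n m → Labelling n m → Labelling n m → Set
ExchangeStep {n} G lab lab' =
  Σ (Fin (n ∸ 1)) λ i → (∀ j → j ≢ i → lab' j ≡ lab j)
                × ¬ Image {n} lab (lab' i)
                × IsLabelledSpanningTree G lab'

data Reconf {n m : ℕ} (G : Graph n m) : ℕ → Labelling n m → Labelling n m → Set where
  done : ∀ {l l' : Labelling n m} → (∀ i → l i ≡ l' i) → Reconf G zero l l'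
  next : ∀ {k} {l l' l'' : Labelling n m} → ExchangeStep G l l' → Reconf G k l' l'' → Reconf G (suc k) l l''

module Submission where

open import Defs
open import Data.Nat using (ℕ; zero; suc; _+_; _*_; _^_; _∸_; _≤_; _<_; _<?_; z≤n; s≤s; s≤s⁻¹; ⌊_/2⌋; ⌈_/2⌉)
open import Data.Nat.Logarithm using (⌈log₂_⌉; ⌈log₂⌈n/2⌉⌉≡⌈log₂n⌉∸1; ⌈log₂⌉-mono-≤)
open import Data.Nat.Properties hiding (_≟_)
open import Data.Nat.Solver using (module +-*-Solver)
open import Data.Empty using (⊥; ⊥-elim)
open import Data.Fin using (Fin; zero; suc; punchIn; punchOut; inject₁; fromℕ)
open import Data.Fin.Permutation.Components using (transpose)
open import Data.Fin.Properties using (_≟_; any?; fromℕ≢inject₁; punchInᵢ≢i; punchIn-punchOut; punchOut-cong; punchOut-punchIn)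
open import Data.Fin.Relation.Unary.Top using (view; ‵fromℕ; ‵inject₁)
open import Data.Fin.Subset using (Subset; _∈_; _∉_; _⊆_; _∪_; _─_; _-_; ⁅_⁆; ∣_∣; inside; outside; Nonempty)
  renaming (⊥ to ∅; ⊤ to full)
open import Data.Fin.Subset.Properties
open import Data.List using (List; []; _∷_; _++_; length; lookup; foldr; allFin)
open import Data.List.Properties using (++-assoc; ++-identityʳ; length-++; length-tabulate)
open import Data.List.Membership.DecPropositional using () renaming (_∈?_ to ∈ᴸ-dec)
open import Data.List.Membership.Propositional using (find) renaming (_∈_ to _∈ᴸ_; _∉_ to _∉ᴸ_)
open import Data.List.Membership.Propositional.Properties using (∈-++⁺ˡ; ∈-++⁺ʳ; ∈-++⁻; ∈-lookup; ∈-allFin)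
open import Data.List.Relation.Unary.All using ([]; _∷_)
import Data.List.Relation.Unary.All as All
open import Data.List.Relation.Unary.All.Properties using (¬Any⇒All¬; All¬⇒¬Any; ¬All⇒Any¬)
open import Data.List.Relation.Unary.AllPairs using ([]; _∷_)
open import Data.List.Relation.Unary.Any using (here; there; index)
open import Data.List.Relation.Unary.Any.Properties using (lookup-index)
open import Data.List.Relation.Unary.Unique.Propositional using (Unique)
open import Data.List.Relation.Unary.Unique.Propositional.Properties using (++⁺)
open import Data.Product using (Σ; ∃; ∃₂; _×_; _,_; proj₁; proj₂)
import Data.Product as Prod
open import Data.Product.Properties using (≡-dec; ,-injective)
open import Data.Sum using (_⊎_; inj₁; inj₂; [_,_]′)
import Data.Sum as Sum
open import Data.Unit using (⊤; tt)
open import Data.Vec using ([]; _∷_; here; there)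
open import Function using (_∘_; id; case_of_)
open import Function.Definitions using (Injective)
open import Relation.Nullary using (¬_; Dec; yes; no; contradiction; ¬?)
open import Relation.Nullary.Decidable using (map′; _×-dec_; _⊎-dec_)
open import Relation.Binary.PropositionalEquality

-- A labelling by n - 1 edges whose image connects G is automatically a labelled spanning
-- tree, so moving one label so that the image stays connected is always an exchange step.
-- Two labels on a common fundamental cycle of a tree T can be swapped in three steps, hence
-- labels at distance d in the fundamental graph of T in O(d) steps. Both labelled trees are
-- first moved to one tree T, exchanging only along cycles; it remains to choose T such
-- that tree edges of the same block have distance O(log n).
--
-- T grows by ears. Let H be a component of the vertices not yet covered. If H sees only one
-- covered vertex a, no block contains edges that meet H and edges that do not, and we start
-- afresh from an edge between a and H. Otherwise put an ear through H; omitting its last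
-- edge, all its edges lie on a fundamental cycle with an older edge, so the distance to the
-- starting edge grows by one. The ear can be chosen so that each component K of the rest of
-- H with two covered neighbours has at most half the size of H: reroute it through an
-- offending K while keeping all ear vertices next to K; a new offending component is larger
-- than half of H too, hence a proper part of K. So the distance to the starting edge is at
-- most log n.

-- Walks, simple walks and cutting at an edge.

module Walks {n m : ℕ} (G : Graph n m) where

  Joins-sym : ∀ {e u v} → Joins G e u v → Joins G e v u
  Joins-sym = Sum.swap

  Joins-unique : ∀ {e u v y z} → Joins G e u v → Joins G e y z →
                 (u ≡ y × v ≡ z) ⊎ (u ≡ z × v ≡ y)
  Joins-unique (inj₁ p) (inj₁ q) = inj₁ (,-injective (trans (sym p) q))
  Joins-unique (inj₁ p) (inj₂ q) = inj₂ (,-injective (trans (sym p) q))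
  Joins-unique (inj₂ p) (inj₁ q) with refl , refl ← ,-injective (trans (sym p) q) = inj₂ (refl , refl)
  Joins-unique (inj₂ p) (inj₂ q) with refl , refl ← ,-injective (trans (sym p) q) = inj₁ (refl , refl)

  private variable
    S T   : EdgeSet m
    e f   : Fin m
    u v x : Fin n

  mapʷ : (∀ {e} → S e → T e) → Walk G S u v → Walk G T u v
  mapʷ h here           = here
  mapʷ h (step e s j w) = step e (h s) j (mapʷ h w)

  infixr 5 _++ʷ_
  _++ʷ_ : Walk G S u v → Walk G S v x → Walk G S u x
  here         ++ʷ w′ = w′
  step e s j w ++ʷ w′ = step e s j (w ++ʷ w′)

  edgeʷ : S e → Joins G e u v → Walk G S u v
  edgeʷ s j = step _ s j here

  symʷ : Walk G S u v → Walk G S v u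
  symʷ here           = here
  symʷ (step e s j w) = symʷ w ++ʷ edgeʷ s (Joins-sym j)

  bindʷ : (∀ {e x y} → S e → Joins G e x y → Walk G T x y) → Walk G S u v → Walk G T u v
  bindʷ h here           = here
  bindʷ h (step e s j w) = h s j ++ʷ bindʷ h w

  verts : Walk G S u v → List (Fin n)
  verts {u = u} here           = u ∷ []
  verts {u = u} (step _ _ _ w) = u ∷ verts w

  edges : Walk G S u v → List (Fin m)
  edges here           = []
  edges (step e _ _ w) = e ∷ edges w

  Simpleʷ : Walk G S u v → Set
  Simpleʷ w = Unique (verts w)

  verts-map : (h : ∀ {e} → S e → T e) (w : Walk G S u v) → verts (mapʷ h w) ≡ verts w
  verts-map h here           = refl
  verts-map h (step e s j w) = cong (_ ∷_) (verts-map h w)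

  ∈edges-map : (h : ∀ {e} → S e → T e) (w : Walk G S u v) → e ∈ᴸ edges w → e ∈ᴸ edges (mapʷ h w)
  ∈edges-map h (step _ _ _ w) (here refl) = here refl
  ∈edges-map h (step _ _ _ w) (there p)   = there (∈edges-map h w p)

  ∈edges-++⁺ˡ : (w : Walk G S u v) (w′ : Walk G S v x) → e ∈ᴸ edges w → e ∈ᴸ edges (w ++ʷ w′)
  ∈edges-++⁺ˡ (step _ _ _ w) w′ (here refl) = here refl
  ∈edges-++⁺ˡ (step _ _ _ w) w′ (there p)   = there (∈edges-++⁺ˡ w w′ p)

  ∈edges-++⁺ʳ : (w : Walk G S u v) (w′ : Walk G S v x) → e ∈ᴸ edges w′ → e ∈ᴸ edges (w ++ʷ w′)
  ∈edges-++⁺ʳ here           w′ p = p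
  ∈edges-++⁺ʳ (step _ _ _ w) w′ p = there (∈edges-++⁺ʳ w w′ p)

  verts-++ : ∀ {y} (w : Walk G S u v) (s : S e) (j : Joins G e v x) (w′ : Walk G S x y) →
             verts (w ++ʷ step e s j w′) ≡ verts w ++ verts w′
  verts-++ here            s j w′ = refl
  verts-++ (step _ _ _ w) s j w′ = cong (_ ∷_) (verts-++ w s j w′)

  first-edge : (w : Walk G S u v) → u ≢ v → ∃ λ e → e ∈ᴸ edges w
  first-edge here           u≢u = contradiction refl u≢u
  first-edge (step e _ _ _) _   = e , here refl

  length-verts : (w : Walk G S u v) → length (verts w) ≡ suc (length (edges w))
  length-verts here           = refl
  length-verts (step e s j w) = cong suc (length-verts w)

  start∈verts : (w : Walk G S u v) → u ∈ᴸ verts w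
  start∈verts here           = here refl
  start∈verts (step _ _ _ w) = here refl

  end∈verts : (w : Walk G S u v) → v ∈ᴸ verts w
  end∈verts here           = here refl
  end∈verts (step _ _ _ w) = there (end∈verts w)

  edges⊆ : (w : Walk G S u v) → e ∈ᴸ edges w → S e
  edges⊆ (step _ s _ _) (here refl) = s
  edges⊆ (step _ _ _ w) (there p)   = edges⊆ w p

  ends∈verts : (w : Walk G S u v) → e ∈ᴸ edges w → ∀ {y z} → Joins G e y z → y ∈ᴸ verts w
  ends∈verts (step _ _ j w) (here refl) j′ with Joins-unique j′ j
  ... | inj₁ (refl , refl) = here refl
  ... | inj₂ (refl , refl) = there (start∈verts w)
  ends∈verts (step _ _ _ w) (there p) j′ = there (ends∈verts w p j′)

  -- `mapʷ` asks for an argument about every edge of the edge set. With the walk's own edges as the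
  -- edge set, only edges that occur have to be treated.
  selfʷ : (w : Walk G S u v) → Σ (Walk G (_∈ᴸ edges w) u v) λ w′ → verts w′ ≡ verts w
  selfʷ here = here , refl
  selfʷ (step e s j w) with selfʷ w
  ... | w′ , eq = step e (here refl) j (mapʷ there w′) , cong (_ ∷_) (trans (verts-map there w′) eq)

  ∈edges-self : (w : Walk G S u v) → e ∈ᴸ edges w → e ∈ᴸ edges (proj₁ (selfʷ w))
  ∈edges-self (step _ _ _ w) (here refl) = here refl
  ∈edges-self (step _ _ _ w) (there p)   = there (∈edges-map there (proj₁ (selfʷ w)) (∈edges-self w p))

  prefixʷ : (w : Walk G S u v) → x ∈ᴸ verts w → Walk G (_∈ᴸ edges w) u x
  prefixʷ here           (here refl) = here
  prefixʷ (step e s j w) (here refl) = here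
  prefixʷ (step e s j w) (there p)   = step e (here refl) j (mapʷ there (prefixʷ w p))

  suffixʷ : (w : Walk G S u v) → Simpleʷ w → x ∈ᴸ verts w → Σ (Walk G S x v) Simpleʷ
  suffixʷ w@here           q       (here refl) = w , q
  suffixʷ w@(step _ _ _ _) q       (here refl) = w , q
  suffixʷ (step _ _ _ w)   (_ ∷ q) (there p)   = suffixʷ w q p

  simplify : Walk G S u v → Σ (Walk G S u v) Simpleʷ
  simplify here = here , [] ∷ []
  simplify {u = u} (step e s j w) with simplify w
  ... | w′ , q with ∈ᴸ-dec _≟_ u (verts w′)
  ...   | yes p = suffixʷ w′ q p
  ...   | no ¬p = step e s j w′ , ¬Any⇒All¬ _ ¬p ∷ q

  -- By disjointness a cut vertex misses one of the two pieces. Linked by an edge between `u` and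
  -- `v`, the pieces form a detour around `f`.
  record Cut (w : Walk G S u v) (f : Fin m) : Set where
    field
      {y z}    : Fin n
      joined   : Joins G f y z
      front    : Walk G (λ e → e ∈ᴸ edges w × e ≢ f) u y
      back     : Walk G (λ e → e ∈ᴸ edges w × e ≢ f) z v
      front⊆   : ∀ {x} → x ∈ᴸ verts front → x ∈ᴸ verts w
      back⊆    : ∀ {x} → x ∈ᴸ verts back → x ∈ᴸ verts w
      disjoint : ∀ {x} → x ∈ᴸ verts front → x ∈ᴸ verts back → ⊥

  cut : (w : Walk G S u v) → Simpleʷ w → f ∈ᴸ edges w → Cut w f
  cut {u = u} (step e s j w) (u∉ ∷ q) (here refl) = record
    { joined   = j
    ; front    = here
    ; back     = mapʷ avoid (proj₁ (selfʷ w))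
    ; front⊆   = λ { (here refl) → here refl }
    ; back⊆    = λ p → there (back∈ p)
    ; disjoint = λ { (here refl) p → All¬⇒¬Any u∉ (back∈ p) }
    }
    where
    -- Simplicity keeps `e` from recurring: otherwise its end `u` would lie on `w`.
    avoid : ∀ {h} → h ∈ᴸ edges w → h ∈ᴸ e ∷ edges w × h ≢ e
    avoid p = there p , λ { refl → All¬⇒¬Any u∉ (ends∈verts w p j) }
    back∈ : ∀ {x} → x ∈ᴸ verts (mapʷ avoid (proj₁ (selfʷ w))) → x ∈ᴸ verts w
    back∈ = subst (_ ∈ᴸ_) (trans (verts-map avoid (proj₁ (selfʷ w))) (proj₂ (selfʷ w)))
  cut {u = u} {f = f} (step e s j w) (u∉ ∷ q) (there p) = record
    { joined   = C.joined
    ; front    = step e (here refl , e≢f) j (mapʷ grow C.front)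
    ; back     = mapʷ grow C.back
    ; front⊆   = λ { (here refl) → here refl ; (there r) → there (C.front⊆ (front∈ r)) }
    ; back⊆    = λ r → there (C.back⊆ (back∈ r))
    ; disjoint = λ { (here refl) r → All¬⇒¬Any u∉ (C.back⊆ (back∈ r))
                   ; (there r′) r → C.disjoint (front∈ r′) (back∈ r) }
    }
    where
    module C = Cut (cut w q p)
    grow : ∀ {h} → h ∈ᴸ edges w × h ≢ f → h ∈ᴸ e ∷ edges w × h ≢ f
    grow (r , h≢f) = there r , h≢f
    e≢f : e ≢ f
    e≢f refl = All¬⇒¬Any u∉ (ends∈verts w p j)
    front∈ : ∀ {x} → x ∈ᴸ verts (mapʷ grow C.front) → x ∈ᴸ verts C.front
    front∈ = subst (_ ∈ᴸ_) (verts-map grow C.front)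
    back∈ : ∀ {x} → x ∈ᴸ verts (mapʷ grow C.back) → x ∈ᴸ verts C.back
    back∈ = subst (_ ∈ᴸ_) (verts-map grow C.back)

  -- Cut vertices and blocks.

  Touches : Subset n → Fin m → Set
  Touches K e = ∃₂ λ x y → Joins G e x y × x ∈ K

  Touches-end : ∀ {K y z} → Touches K e → Joins G e y z → y ∈ K ⊎ z ∈ K
  Touches-end (_ , _ , j , p) j′ with Joins-unique j j′
  ... | inj₁ (refl , refl) = inj₁ p
  ... | inj₂ (refl , refl) = inj₂ p

  -- Here a is a cut vertex, or K is everything but a.
  HangsAt : Fin n → Subset n → Set
  HangsAt a K = a ∉ K × (∀ {e x y} → Joins G e x y → x ∈ K → y ∈ K ⊎ y ≡ a)

  -- Edges between `K` and its complement all end in `a`, so a walk that misses `a` cannot change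
  -- sides.
  avoid-invariant : ∀ {a K} → HangsAt a K → (w : Walk G S u v) → a ∉ᴸ verts w →
                    (u ∈ K → v ∈ K) × (v ∈ K → u ∈ K)
  avoid-invariant h here _ = id , id
  avoid-invariant {a = a} {K = K} h (step {u} {x} e s j w) a∉ with avoid-invariant h w (a∉ ∘ there)
  ... | to , from = (λ p → to (fwd p)) , (λ p → bwd (from p))
    where
    fwd : u ∈ K → x ∈ K
    fwd p with proj₂ h j p
    ... | inj₁ r    = r
    ... | inj₂ refl = contradiction (there (start∈verts w)) a∉
    bwd : x ∈ K → u ∈ K
    bwd p with proj₂ h (Joins-sym j) p
    ... | inj₁ r    = r
    ... | inj₂ refl = contradiction (here refl) a∉

  infix 4 _≈ᵇ_
  -- Used in place of SameBlock, whose transitivity is not obvious.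
  _≈ᵇ_ : Fin m → Fin m → Set
  e ≈ᵇ f = ∀ {a K} → HangsAt a K → (Touches K e → Touches K f) × (Touches K f → Touches K e)

  ≈ᵇ-refl : ∀ {e} → e ≈ᵇ e
  ≈ᵇ-refl _ = id , id

  ≈ᵇ-reflexive : ∀ {e f} → e ≡ f → e ≈ᵇ f
  ≈ᵇ-reflexive refl = ≈ᵇ-refl

  ≈ᵇ-sym : ∀ {e f} → e ≈ᵇ f → f ≈ᵇ e
  ≈ᵇ-sym p h = proj₂ (p h) , proj₁ (p h)

  ≈ᵇ-trans : ∀ {e f g} → e ≈ᵇ f → f ≈ᵇ g → e ≈ᵇ g
  ≈ᵇ-trans p q h = proj₁ (q h) ∘ proj₁ (p h) , proj₂ (p h) ∘ proj₂ (q h)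

  -- A cut vertex misses one of the two pieces into which f cuts w, and that piece
  -- runs from an end of f to an end of the closing edge g.
  closed-≈ᵇ : ∀ {g} (w : Walk G S u v) → Simpleʷ w → Joins G g u v → f ∈ᴸ edges w → g ≈ᵇ f
  closed-≈ᵇ {f = f} {g = g} w q jg f∈ {a} {K} h = helper (∈ᴸ-dec _≟_ a (verts C.front))
    where
    module C = Cut (cut w q f∈)
    -- As `x` differs from `a`, it lies in `K` as soon as either end of `e` does.
    transfer : ∀ {e e′ x y x′ y′} → Joins G e x y → Joins G e′ x′ y′ → x ≢ a →
               (x ∈ K → x′ ∈ K) → Touches K e → Touches K e′
    transfer j j′ x≢a imp t with Touches-end t j
    ... | inj₁ p = _ , _ , j′ , imp p
    ... | inj₂ p with proj₂ h (Joins-sym j) p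
    ...   | inj₁ p′   = _ , _ , j′ , imp p′
    ...   | inj₂ refl = contradiction refl x≢a
    helper : Dec (a ∈ᴸ verts C.front) → (Touches K g → Touches K f) × (Touches K f → Touches K g)
    helper (no a∉) =
      let to , from = avoid-invariant h C.front a∉ in
      transfer jg C.joined (λ { refl → a∉ (start∈verts C.front) }) to ,
      transfer C.joined jg (λ { refl → a∉ (end∈verts C.front) }) from
    helper (yes a∈) =
      let a∉ = C.disjoint a∈
          to , from = avoid-invariant h C.back a∉ in
      transfer (Joins-sym jg) (Joins-sym C.joined) (λ { refl → a∉ (end∈verts C.back) }) from ,
      transfer (Joins-sym C.joined) (Joins-sym jg) (λ { refl → a∉ (start∈verts C.back) }) to

  -- The last component serves the induction: with injectivity of `vs` it keeps the new first vertex
  -- off the rest of the walk.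
  path⇒walk : ∀ k (vs : Fin (suc k) → Fin n) (es : Fin k → Fin m) → Injective _≡_ _≡_ vs →
              (∀ i → Joins G (es i) (vs (inject₁ i)) (vs (suc i))) →
              Σ (Walk G (λ e → ∃ λ i → es i ≡ e) (vs zero) (vs (fromℕ k))) λ w →
                Simpleʷ w × (∀ i → es i ∈ᴸ edges w) × (∀ {x} → x ∈ᴸ verts w → ∃ λ i → vs i ≡ x)
  path⇒walk zero vs es inj js = here , [] ∷ [] , (λ ()) , λ { (here refl) → zero , refl }
  path⇒walk (suc k) vs es inj js
    with path⇒walk k (vs ∘ suc) (es ∘ suc) (λ eq → case inj eq of λ { refl → refl }) (js ∘ suc)
  ... | w , q , on , off =
    step (es zero) (zero , refl) (js zero) w′ ,
    ¬Any⇒All¬ _ (λ p → case inj (proj₂ (off (back∈ p))) of λ ()) ∷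
      subst Unique (sym (verts-map sh w)) q ,
    (λ { zero → here refl ; (suc i) → there (∈edges-map sh w (on i)) }) ,
    λ { (here refl) → zero , refl ; (there p) → let i , eq = off (back∈ p) in suc i , eq }
    where
    sh : ∀ {e} → (∃ λ i → es (suc i) ≡ e) → ∃ λ i → es i ≡ e
    sh (i , eq) = suc i , eq
    w′ = mapʷ sh w
    back∈ : ∀ {x} → x ∈ᴸ verts w′ → x ∈ᴸ verts w
    back∈ = subst (_ ∈ᴸ_) (verts-map sh w)

  -- Both edges are compared with the closing edge of the cycle; the other edges form a simple path
  -- that it closes.
  SameBlock⇒≈ᵇ : ∀ {e f} → SameBlock G e f → e ≈ᵇ f
  SameBlock⇒≈ᵇ (inj₁ refl) = ≈ᵇ-refl
  SameBlock⇒≈ᵇ (inj₂ (C , (i , refl) , (j , refl))) = ≈ᵇ-trans (≈ᵇ-sym (last-≈ᵇ i)) (last-≈ᵇ j)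
    where
    last-≈ᵇ : ∀ i → es C (fromℕ (k C)) ≈ᵇ es C i
    last-≈ᵇ i with view i
    ... | ‵fromℕ = ≈ᵇ-refl
    ... | ‵inject₁ i′ =
      let w , q , on , _ = path⇒walk (k C) (vs C) (es C ∘ inject₁) (vs-inj C) (joins C) in
      closed-≈ᵇ w q (Joins-sym (closes C)) (on i′)

-- Edge counts of connected graphs.

distinct-edge : ∀ {n m} (G : Graph n m) {S u v} → Walk G S u v → u ≢ v →
                ∃ λ e → ∃₂ λ x y → Joins G e x y × x ≢ y
distinct-edge G here u≢v = contradiction refl u≢v
distinct-edge G (step {u} {x} e s j w) u≢v with u ≟ x
... | no u≢x   = e , u , x , j , u≢x
... | yes refl = distinct-edge G w u≢v

-- Contract an edge between distinct vertices and induct.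
connected⇒edges : ∀ {a b} (H : Graph (suc a) b) → Connected H (λ _ → ⊤) → a ≤ b
connected⇒edges {zero} H con = z≤n
connected⇒edges {suc a} {b} H con with distinct-edge H (con zero (suc zero)) (λ ())
connected⇒edges {suc a} {suc b} H con | e , u , v , j , u≢v = s≤s (connected⇒edges H′ con′)
  where
  -- The contraction: `v` is identified with `u`, and the other vertices are renumbered by leaving
  -- out `v`.
  q : Fin (suc (suc a)) → Fin (suc a)
  q w with v ≟ w
  ... | yes _  = punchOut {i = v} {j = u} (u≢v ∘ sym)
  ... | no v≢w = punchOut v≢w
  q-punchIn : ∀ x → q (punchIn v x) ≡ x
  q-punchIn x with v ≟ punchIn v x
  ... | yes eq = contradiction (sym eq) (punchInᵢ≢i v x)
  ... | no  ne = trans (punchOut-cong v refl) (punchOut-punchIn v)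
  q-merge : q u ≡ q v
  q-merge with v ≟ u | v ≟ v
  ... | yes v≡u | _      = contradiction (sym v≡u) u≢v
  ... | no _    | no v≢v = contradiction refl v≢v
  ... | no _    | yes _  = punchOut-cong v refl
  H′ : Graph (suc a) b
  H′ = record { ends = λ i → q (proj₁ (ends H (punchIn e i))) , q (proj₂ (ends H (punchIn e i))) }
  joins′ : ∀ i {x y} → Joins H (punchIn e i) x y → Joins H′ i (q x) (q y)
  joins′ i (inj₁ eq) = inj₁ (cong (λ p → q (proj₁ p) , q (proj₂ p)) eq)
  joins′ i (inj₂ eq) = inj₂ (cong (λ p → q (proj₁ p) , q (proj₂ p)) eq)
  walk′ : ∀ {x y} → Walk H (λ _ → ⊤) x y → Walk H′ (λ _ → ⊤) (q x) (q y)
  walk′ here = here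
  walk′ (step {x} {z} e′ s j′ w) with e ≟ e′
  ... | no e≢e′ = step (punchOut e≢e′) tt
                    (joins′ (punchOut e≢e′) (subst (λ h → Joins H h x z) (sym (punchIn-punchOut e≢e′)) j′))
                    (walk′ w)
  ... | yes refl with Walks.Joins-unique H j′ j
  ...   | inj₁ (refl , refl) = subst (λ t → Walk H′ _ t (q _)) (sym q-merge) (walk′ w)
  ...   | inj₂ (refl , refl) = subst (λ t → Walk H′ _ t (q _)) q-merge (walk′ w)
  con′ : Connected H′ (λ _ → ⊤)
  con′ x y = subst₂ (Walk H′ _) (q-punchIn x) (q-punchIn y) (walk′ (con (punchIn v x) (punchIn v y)))

module _ {a m : ℕ} {G : Graph (suc a) m} where

  open Walks G using (mapʷ)

  -- The family is read as a multigraph of its own, where repeated edges become parallel ones.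
  connected⇒family≥ : ∀ {b} (lab : Fin b → Fin m) → Connected G (λ e → ∃ λ i → lab i ≡ e) → a ≤ b
  connected⇒family≥ lab con = connected⇒edges H λ u v → walk′ (con u v)
    where
    H : Graph (suc a) _
    H = record { ends = ends G ∘ lab }
    walk′ : ∀ {x y} → Walk G (λ e → ∃ λ i → lab i ≡ e) x y → Walk H (λ _ → ⊤) x y
    walk′ here                      = here
    walk′ (step _ (i , refl) j w) = step i tt j (walk′ w)

  connected⇒length≥ : ∀ (L : List (Fin m)) → Connected G (_∈ᴸ L) → a ≤ length L
  connected⇒length≥ L con = connected⇒family≥ (lookup L) λ u v →
    mapʷ (λ p → index p , sym (lookup-index p)) (con u v)

module _ {n m : ℕ} {G : Graph n m} where

  open Walks G

  -- Without label `i` only n - 2 edges remain, one too few to connect n vertices.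
  no-spare-label : (lab : Labelling n m) (i : Fin (n ∸ 1)) →
                   ¬ Connected G (λ e → ∃ λ j → j ≢ i × lab j ≡ e)
  no-spare-label = go n G
    where
    -- `n` is taken as an argument again to allow matching on it; for n at most 1 there is no label
    -- `i`.
    go : ∀ n (G : Graph n m) (lab : Labelling n m) (i : Fin (n ∸ 1)) →
         ¬ Connected G (λ e → ∃ λ j → j ≢ i × lab j ≡ e)
    go (suc (suc a)) G lab i con = 1+n≰n (connected⇒family≥ {G = G} (lab ∘ punchIn i) λ u v →
      Walks.mapʷ G (λ { (j , j≢i , eq) → punchOut (j≢i ∘ sym) , trans (cong lab (punchIn-punchOut (j≢i ∘ sym))) eq }) (con u v))

  -- Of two labels on the same edge, one would be spare.
  connected⇒injective : (lab : Labelling n m) → Connected G (Image {n} lab) → Injective _≡_ _≡_ lab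
  connected⇒injective lab con {i} {j} eq with j ≟ i
  ... | yes refl = refl
  ... | no j≢i = ⊥-elim (no-spare-label lab i λ u v → mapʷ other (con u v))
    where
    other : ∀ {e} → Image {n} lab e → ∃ λ l → l ≢ i × lab l ≡ e
    other (l , refl) with l ≟ i
    ... | yes refl = j , j≢i , sym eq
    ... | no l≢i   = l , l≢i , refl

  -- The label of a cycle's closing edge would be spare, because the rest of the cycle bypasses that
  -- edge.
  connected⇒acyclic : (lab : Labelling n m) → Connected G (Image {n} lab) → Acyclic G (Image {n} lab)
  connected⇒acyclic lab con (C , all) = no-spare-label lab i λ u v → bindʷ reroute (con u v)
    where
    i = proj₁ (all (fromℕ (k C)))
    Rest : EdgeSet m
    Rest e = ∃ λ j → j ≢ i × lab j ≡ e
    around : Walk G Rest (vs C zero) (vs C (fromℕ (k C)))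
    around = mapʷ
      (λ { (j , refl) → proj₁ (all (inject₁ j)) ,
            (λ eq → fromℕ≢inject₁ (es-inj C (trans (sym (proj₂ (all _))) (trans (cong lab (sym eq)) (proj₂ (all _)))))) ,
            proj₂ (all (inject₁ j)) })
      (proj₁ (path⇒walk (k C) (vs C) (es C ∘ inject₁) (vs-inj C) (joins C)))
    reroute : ∀ {e x y} → Image {n} lab e → Joins G e x y → Walk G Rest x y
    reroute (j , refl) jn with j ≟ i
    ... | no j≢i = edgeʷ (j , j≢i , refl) jn
    ... | yes refl with Joins-unique jn (subst (λ e → Joins G e _ _) (sym (proj₂ (all (fromℕ (k C))))) (closes C))
    ...   | inj₁ (refl , refl) = symʷ around
    ...   | inj₂ (refl , refl) = around

  connected⇒tree : (lab : Labelling n m) → Connected G (Image {n} lab) → IsLabelledSpanningTree G lab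
  connected⇒tree lab con = connected⇒injective lab con , con , connected⇒acyclic lab con

-- Transpositions of edges and changes of one label.

module _ {m : ℕ} (p q : Fin m) where

  transpose-left : transpose p q p ≡ q
  transpose-left with p ≟ p
  ... | yes _  = refl
  ... | no p≢p = contradiction refl p≢p

  transpose-right : transpose p q q ≡ p
  transpose-right with q ≟ p
  ... | yes q≡p = q≡p
  ... | no _ with q ≟ q
  ...   | yes _  = refl
  ...   | no q≢q = contradiction refl q≢q

  transpose-other : ∀ {x} → x ≢ p → x ≢ q → transpose p q x ≡ x
  transpose-other {x} x≢p x≢q with x ≟ p
  ... | yes x≡p = contradiction x≡p x≢p
  ... | no _ with x ≟ q
  ...   | yes x≡q = contradiction x≡q x≢q
  ...   | no _    = refl

  transpose-elim : ∀ {ℓ} (P : Fin m → Fin m → Set ℓ) → P p q → P q p →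
                   (∀ {x} → x ≢ p → x ≢ q → P x x) → ∀ x → P x (transpose p q x)
  transpose-elim P l r o x with x ≟ p
  ... | yes refl = l
  ... | no x≢p with x ≟ q
  ...   | yes refl = r
  ...   | no x≢q   = o x≢p x≢q

transpose-same : ∀ {m} (p x : Fin m) → transpose p p x ≡ x
transpose-same p = transpose-elim p p (λ x y → y ≡ x) refl refl (λ _ _ → refl)

-- The conjugation (p q) = (p x)(x q)(p x) turns a swap of distant edges into swaps of adjacent ones
-- along a path.
transpose-conjugate : ∀ {m} {p x q : Fin m} → p ≢ x → q ≢ p → q ≢ x →
                      ∀ y → transpose p x (transpose x q (transpose p x y)) ≡ transpose p q y
transpose-conjugate {p = p} {x} {q} p≢x q≢p q≢x =
  transpose-elim p q (λ y z → transpose p x (transpose x q (transpose p x y)) ≡ z)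
    (three p (transpose-left p x) (transpose-left x q) (transpose-other p x q≢p q≢x))
    (three q (transpose-other p x q≢p q≢x) (transpose-right x q) (transpose-right p x))
    (λ {y} y≢p y≢q → other y≢p y≢q (y ≟ x))
  where
  three : ∀ y {a b c} → transpose p x y ≡ a → transpose x q a ≡ b → transpose p x b ≡ c →
          transpose p x (transpose x q (transpose p x y)) ≡ c
  three _ refl refl refl = refl
  other : ∀ {y} → y ≢ p → y ≢ q → Dec (y ≡ x) → transpose p x (transpose x q (transpose p x y)) ≡ y
  other y≢p y≢q (yes refl) =
    three x (transpose-right p x) (transpose-other x q p≢x (q≢p ∘ sym)) (transpose-left p x)
  other {y} y≢p y≢q (no y≢x) =
    three y (transpose-other p x y≢p y≢x) (transpose-other x q y≢x y≢q) (transpose-other p x y≢p y≢x)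

module _ {k m : ℕ} (l : Fin k → Fin m) (i : Fin k) (e : Fin m) where

  relabel : Fin k → Fin m
  relabel j with j ≟ i
  ... | yes _ = e
  ... | no _  = l j

  relabel-hit : relabel i ≡ e
  relabel-hit with i ≟ i
  ... | yes _  = refl
  ... | no i≢i = contradiction refl i≢i

  relabel-miss : ∀ {j} → j ≢ i → relabel j ≡ l j
  relabel-miss {j} j≢i with j ≟ i
  ... | yes j≡i = contradiction j≡i j≢i
  ... | no _    = refl

-- Exchange sequences and distances in the fundamental graph.

module Exchange {n m : ℕ} (G : Graph n m) where

  open Walks G public

  Label : Set
  Label = Fin (n ∸ 1)

  private variable
    l l′ l″ : Labelling n m
    S T     : EdgeSet m
    a b d   : ℕ
    p q g f : Fin m

  Spans : Labelling n m → Set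
  Spans l = Connected G (Image {n} l)

  -- An upper bound on the number of steps, since a requested change may turn out to be trivial and
  -- then takes no step.
  Reach : ℕ → Labelling n m → Labelling n m → Set
  Reach a l l′ = ∃ λ k → k ≤ a × Reconf G k l l′

  ExchangeStep-respˡ : (∀ i → l i ≡ l′ i) → ExchangeStep G l′ l″ → ExchangeStep G l l″
  ExchangeStep-respˡ eq (i , same , new , tree) =
    i , (λ j j≢i → trans (same j j≢i) (sym (eq j))) , (λ { (j , eq′) → new (j , trans (sym (eq j)) eq′) }) , tree

  Reconf-respˡ : (∀ i → l i ≡ l′ i) → Reconf G a l′ l″ → Reconf G a l l″
  Reconf-respˡ eq (done eq′) = done λ i → trans (eq i) (eq′ i)
  Reconf-respˡ {l} {l′} eq (next s r) = next (ExchangeStep-respˡ {l} {l′} eq s) r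

  Reconf-trans : Reconf G a l l′ → Reconf G b l′ l″ → Reconf G (a + b) l l″
  Reconf-trans (done eq)  r′ = Reconf-respˡ eq r′
  Reconf-trans (next s r) r′ = next s (Reconf-trans r r′)

  reach-refl : (∀ i → l i ≡ l′ i) → Reach a l l′
  reach-refl eq = 0 , z≤n , done eq

  reach-trans : Reach a l l′ → Reach b l′ l″ → Reach (a + b) l l″
  reach-trans (_ , p , r) (_ , q , r′) = _ , +-mono-≤ p q , Reconf-trans r r′

  reach-≤ : a ≤ b → Reach a l l′ → Reach b l l′
  reach-≤ a≤b (_ , p , r) = _ , ≤-trans p a≤b , r

  reach-respʳ : (∀ i → l′ i ≡ l″ i) → Reach a l l′ → Reach a l l″
  reach-respʳ {a = a} eq r = reach-≤ (≤-reflexive (+-identityʳ a)) (reach-trans r (reach-refl eq))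

  -- Spanning labellings are automatically injective and acyclic, so the new edge
  -- cannot be one of the old ones unless nothing changes.
  reach-one : (i : Label) → (∀ j → j ≢ i → l′ j ≡ l j) → Spans l′ → Reach 1 l l′
  reach-one {l′ = l′} {l = l} i same sp with any? (λ j → l j ≟ l′ i)
  ... | no new = 1 , ≤-refl , next (i , same , new , connected⇒tree l′ sp) (done λ _ → refl)
  ... | yes (j , eq) with j ≟ i
  ...   | no j≢i   = contradiction (connected⇒injective l′ sp (trans (same j j≢i) eq)) j≢i
  ...   | yes refl = reach-refl λ h → case h ≟ i of λ
          { (yes refl) → eq ; (no h≢i) → sym (same h h≢i) }

  -- `g` can replace `p`. For a tree edge `p` and an edge `g` outside the tree `T`, this says that
  -- `p` lies on the fundamental cycle of `g`.
  Patch : EdgeSet m → Fin m → Fin m → Set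
  Patch T p g = ∃₂ λ y z → Joins G p y z × Walk G (λ e → (T e × e ≢ p) ⊎ e ≡ g) y z

  Patch-mono : (∀ {e} → S e → T e) → Patch S p g → Patch T p g
  Patch-mono h (y , z , j , w) = y , z , j , mapʷ [ (λ { (s , e≢p) → inj₁ (h s , e≢p) }) , inj₂ ]′ w

  -- The cycle formed by `w` and `g`, with `f` left out, links the ends of `f`.
  closed-Patch : ∀ {u v} (w : Walk G S u v) → Simpleʷ w → Joins G g u v → f ∈ᴸ edges w → Patch S f g
  closed-Patch w q jg f∈ =
    _ , _ , C.joined ,
    symʷ (mapʷ old C.front) ++ʷ edgeʷ (inj₂ refl) jg ++ʷ symʷ (mapʷ old C.back)
    where
    module C = Cut (cut w q f∈)
    old : ∀ {e} → e ∈ᴸ edges w × e ≢ _ → _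
    old (e∈ , e≢f) = inj₁ (edges⊆ w e∈ , e≢f)

  -- Each passage over `p` is replaced by the patch. `U` is arbitrary so that the image of a changed
  -- labelling can be put in directly.
  patch-connected : Connected G S → (∀ {e} → T e → S e) → Patch T p g →
                    (U : EdgeSet m) → (∀ {e} → S e → e ≢ p → U e) → U g → Connected G U
  patch-connected {S} {T} {p} con T⊆S (y , z , jp , w) U old new u v = bindʷ reroute (con u v)
    where
    w′ : Walk G U y z
    w′ = mapʷ [ (λ { (t , e≢p) → old (T⊆S t) e≢p }) , (λ { refl → new }) ]′ w
    reroute : ∀ {e x x′} → S e → Joins G e x x′ → Walk G U x x′
    reroute {e} s j with e ≟ p
    ... | no e≢p = edgeʷ (old s e≢p) j
    ... | yes refl with Joins-unique j jp
    ...   | inj₁ (refl , refl) = w′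
    ...   | inj₂ (refl , refl) = symʷ w′

  Adj : EdgeSet m → Fin m → Fin m → Set
  Adj T p q = ∃ λ g → Patch T p g × Patch T q g

  Adj-sym : Adj T p q → Adj T q p
  Adj-sym (g , x , y) = g , y , x

  -- `nil` exists at every `d`, so `d` bounds the distance from above. The edges along the path must
  -- lie in `T` because they have to carry labels that can be swapped.
  data Dist (T : EdgeSet m) : ℕ → Fin m → Fin m → Set where
    nil  : Dist T d p p
    cons : Adj T p q → T q → Dist T d q f → Dist T (suc d) p f

  -- Distances found in a partial tree therefore stay valid while the tree grows.
  Dist-mono : (∀ {e} → S e → T e) → Dist S d p q → Dist T d p q
  Dist-mono h nil = nil
  Dist-mono h (cons (g , x , y) s r) = cons (g , Patch-mono h x , Patch-mono h y) (h s) (Dist-mono h r)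

  Dist-≤ : a ≤ b → Dist T a p q → Dist T b p q
  Dist-≤ a≤b       nil          = nil
  Dist-≤ (s≤s a≤b) (cons x s r) = cons x s (Dist-≤ a≤b r)

  Dist-trans : Dist T a p q → Dist T b q f → Dist T (a + b) p f
  Dist-trans {a = a} {b = b} nil r′ = Dist-≤ (≤-trans (m≤m+n b a) (≤-reflexive (+-comm b a))) r′
  Dist-trans (cons x s r) r′ = cons x s (Dist-trans r r′)

  Dist-sym : T p → Dist T d p q → Dist T d q p
  Dist-sym t nil = nil
  Dist-sym {d = suc d} t (cons x s r) =
    Dist-≤ (≤-reflexive (+-comm d 1)) (Dist-trans (Dist-sym s r) (cons (Adj-sym x) t nil))

  image-transpose : Image {n} l p → Image {n} l q → ∀ {e} → Image {n} l e → Image {n} (transpose p q ∘ l) e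
  image-transpose {l} {p} {q} (i , li) (j , lj) {e} (h , refl) with l h ≟ p | l h ≟ q
  ... | yes refl | _        = j , trans (cong (transpose p q) lj) (transpose-right p q)
  ... | no _     | yes refl = i , trans (cong (transpose p q) li) (transpose-left p q)
  ... | no ≢p    | no ≢q    = h , transpose-other p q ≢p ≢q

  Spans-transpose : Spans l → Image {n} l p → Image {n} l q → Spans (transpose p q ∘ l)
  Spans-transpose {l} sp ip iq u v = mapʷ (image-transpose {l} ip iq) (sp u v)

  -- The edge g of the common fundamental cycle serves as a parking place.
  reach-swap : Spans l → (∀ {e} → T e → Image {n} l e) → Adj T p q → p ≢ q →
               Image {n} l p → Image {n} l q → Reach 3 l (transpose p q ∘ l)
  reach-swap {l} {T} {p} {q} sp T⊆ (g , pp , pq) p≢q (i , li) (j , lj) =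
    reach-trans (reach-one i (λ h h≢i → relabel-miss l i g h≢i) sp₁)
      (reach-trans (reach-one j (λ h h≢j → relabel-miss l₁ j p h≢j) sp₂)
        (reach-one i third (Spans-transpose {l} sp (i , li) (j , lj))))
    where
    i≢j : i ≢ j
    i≢j refl = p≢q (trans (sym li) lj)
    -- Label `i` moves from `p` to `g`, then `j` from `q` to `p`, and finally `i` from `g` to `q`.
    l₁ l₂ : Labelling n m
    l₁ = relabel l i g
    l₂ = relabel l₁ j p
    sp₁ : Spans l₁
    sp₁ = patch-connected sp T⊆ pp (Image {n} l₁)
      (λ { (h , refl) ≢p → h , relabel-miss l i g (λ { refl → ≢p li }) })
      (i , relabel-hit l i g)
    -- As an edge set, `l₂` is `l` with `q` replaced by `g`, so the patch of `q` applies to `l`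
    -- itself.
    sp₂ : Spans l₂
    sp₂ = patch-connected sp T⊆ pq (Image {n} l₂) keep
      (i , trans (relabel-miss l₁ j p i≢j) (relabel-hit l i g))
      where
      keep : ∀ {e} → Image {n} l e → e ≢ q → Image {n} l₂ e
      keep (h , refl) ≢q with h ≟ i
      ... | yes refl = j , trans (relabel-hit l₁ j p) (sym li)
      ... | no h≢i   = h , trans (relabel-miss l₁ j p {h} (λ { refl → ≢q lj })) (relabel-miss l i g {h} h≢i)
    inj : Injective _≡_ _≡_ l
    inj = connected⇒injective l sp
    third : ∀ h → h ≢ i → transpose p q (l h) ≡ l₂ h
    third h h≢i with h ≟ j
    ... | yes refl = trans (cong (transpose p q) lj) (transpose-right p q)
    ... | no h≢j =
      trans (transpose-other p q (λ eq → h≢i (inj (trans eq (sym li)))) (λ eq → h≢j (inj (trans eq (sym lj)))))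
            (sym (relabel-miss l i g h≢i))

  reach-transpose : Dist T d p q → T p → T q → Spans l → (∀ {e} → T e → Image {n} l e) →
                    Reach (6 * d) l (transpose p q ∘ l)
  reach-transpose {p = p} nil _ _ sp T⊆ = reach-refl λ i → sym (transpose-same p _)
  reach-transpose {T} {suc d} {p} {q} {l} (cons {q = x} adj tx r) tp tq sp T⊆
    with q ≟ p | q ≟ x | p ≟ x
  ... | yes refl | _ | _ = reach-refl λ i → sym (transpose-same p _)
  ... | no q≢p | yes refl | _ =
    reach-≤ (≤-trans (m≤m+n 3 (3 + 6 * d)) (≤-reflexive (sym (*-suc 6 d))))
      (reach-swap sp T⊆ adj (q≢p ∘ sym) (T⊆ tp) (T⊆ tq))
  ... | no _ | no _ | yes refl = reach-≤ (*-monoʳ-≤ 6 (n≤1+n d)) (reach-transpose r tp tq sp T⊆)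
  ... | no q≢p | no q≢x | no p≢x =
    reach-≤ bound (reach-respʳ (λ i → transpose-conjugate p≢x q≢p q≢x (l i))
      (reach-trans (reach-swap sp T⊆ adj p≢x (T⊆ tp) (T⊆ tx))
        (reach-trans (reach-transpose r tx tq sp₁ T⊆₁)
          (reach-swap sp₂ T⊆₂ adj p≢x (T⊆₂ tp) (T⊆₂ tx)))))
    where
    l₁ l₂ : Labelling n m
    l₁ = transpose p x ∘ l
    l₂ = transpose x q ∘ l₁
    T⊆₁ : ∀ {e} → T e → Image {n} l₁ e
    T⊆₁ t = image-transpose {l} (T⊆ tp) (T⊆ tx) (T⊆ t)
    sp₁ : Spans l₁
    sp₁ = Spans-transpose {l} sp (T⊆ tp) (T⊆ tx)
    T⊆₂ : ∀ {e} → T e → Image {n} l₂ e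
    T⊆₂ t = image-transpose {l₁} (T⊆₁ tx) (T⊆₁ tq) (T⊆₁ t)
    sp₂ : Spans l₂
    sp₂ = Spans-transpose {l₁} sp₁ (T⊆₁ tx) (T⊆₁ tq)
    bound : 3 + (6 * d + 3) ≤ 6 * suc d
    bound = ≤-reflexive (trans (cong (3 +_) (+-comm (6 * d) 3)) (sym (*-suc 6 d)))

  -- Sorting the labels within a fixed tree.

  module _ {T : EdgeSet m} {D : ℕ}
           (near : ∀ {p q} → T p → T q → p ≈ᵇ q → Dist T D p q)
           {l₂ : Labelling n m} (sp₂ : Spans l₂) (l₂∈T : ∀ i → T (l₂ i)) where

    record Sortable (l : Labelling n m) : Set where
      field
        spans : Spans l
        T⊆    : ∀ {e} → T e → Image {n} l e
        ⊆T    : ∀ i → T (l i)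
        close : ∀ i → l i ≈ᵇ l₂ i

    sort-one : Sortable l → (i : Label) → Σ (Labelling n m) λ l′ →
               Sortable l′ × Reach (6 * D) l l′ × l′ i ≡ l₂ i × (∀ {h} → l h ≡ l₂ h → l′ h ≡ l₂ h)
    sort-one {l} s i with l i ≟ l₂ i
    ... | yes eq = l , s , reach-refl (λ _ → refl) , eq , id
    ... | no li≢ = transpose (l i) (l₂ i) ∘ l , s′ ,
                   reach-transpose (near (⊆T i) (l₂∈T i) (close i)) (⊆T i) (l₂∈T i) spans T⊆ ,
                   transpose-left (l i) (l₂ i) , keep
      where
      open Sortable s
      s′ : Sortable (transpose (l i) (l₂ i) ∘ l)
      s′ = record
        { spans = Spans-transpose {l} spans (i , refl) (T⊆ (l₂∈T i))
        ; T⊆    = λ t → image-transpose {l} (i , refl) (T⊆ (l₂∈T i)) (T⊆ t)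
        ; ⊆T    = λ h → transpose-elim (l i) (l₂ i) (λ x y → T x → T y)
                          (λ _ → l₂∈T i) (λ _ → ⊆T i) (λ _ _ → id) (l h) (⊆T h)
        -- The label displaced from `l₂ i` lands on `l i`, and it stays in its block since `l i` and
        -- `l₂ i` share one.
        ; close = λ h → transpose-elim (l i) (l₂ i) (λ x y → l h ≡ x → y ≈ᵇ l₂ h)
            (λ eq → ≈ᵇ-reflexive (cong l₂ (sym (connected⇒injective l spans eq))))
            (λ eq → ≈ᵇ-trans (close i) (subst (λ x → x ≈ᵇ l₂ h) eq (close h)))
            (λ { _ _ refl → close h }) (l h) refl
        }
      -- A label already in place sits neither on `l i` nor on `l₂ i`, by injectivity of `l` and
      -- `l₂`.
      keep : ∀ {h} → l h ≡ l₂ h → transpose (l i) (l₂ i) (l h) ≡ l₂ h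
      keep {h} eq with h ≟ i
      ... | yes refl = contradiction eq li≢
      ... | no h≢i   = trans (transpose-other (l i) (l₂ i)
              (λ eq′ → h≢i (connected⇒injective l spans eq′))
              (λ eq′ → h≢i (connected⇒injective l₂ sp₂ (trans (sym eq) eq′)))) eq

    sort-list : (is : List Label) → Sortable l → Σ (Labelling n m) λ l′ →
                Reach (length is * (6 * D)) l l′ × Sortable l′ ×
                (∀ {h} → h ∈ᴸ is → l′ h ≡ l₂ h) × (∀ {h} → l h ≡ l₂ h → l′ h ≡ l₂ h)
    sort-list []       s = _ , reach-refl (λ _ → refl) , s , (λ ()) , id
    sort-list (i ∷ is) s with sort-one s i
    ... | l₁ , s₁ , r₁ , hit , keep with sort-list is s₁
    ...   | l′ , r , s′ , hits , keep′ =
      l′ , reach-trans r₁ r , s′ , (λ { (here refl) → keep′ hit ; (there p) → hits p }) , keep′ ∘ keep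

    reach-sorted : Sortable l → Reach ((n ∸ 1) * (6 * D)) l l₂
    reach-sorted s with sort-list (allFin _) s
    ... | l′ , r , _ , hits , _ =
      subst (λ a → Reach (a * (6 * D)) _ l₂) (length-tabulate {n = n ∸ 1} id) (reach-respʳ (λ i → hits (∈-allFin i)) r)

  -- Moving a labelled tree onto a fixed tree.

  module _ (t : Labelling n m) (spt : Spans t) where

    -- Both directions are recorded: the first labelled tree moves to its goal, and the approach of
    -- the second is traversed backwards.
    record Approach (l : Labelling n m) (a : ℕ) (js : List Label) : Set where
      field
        {goal} : Labelling n m
        spans  : Spans goal
        to     : Reach a l goal
        from   : Reach a goal l
        close  : ∀ i → l i ≈ᵇ goal i
        hits   : ∀ {j} → j ∈ᴸ js → Image {n} goal (t j)
        keeps  : ∀ {j} → Image {n} l (t j) → Image {n} goal (t j)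

    -- The path of `l` between the ends of `t j` contains an edge `f` outside `t`, whose label moves
    -- to `t j`. No edge of `t` is given up, and `f` and `t j` lie on a common cycle.
    approach-one : Spans l → (j : Label) → Approach l 1 (j ∷ [])
    approach-one {l} sp j with any? (λ i → l i ≟ t j)
    ... | yes p = record
      { spans = sp ; to = reach-refl λ _ → refl ; from = reach-refl λ _ → refl
      ; close = λ _ → ≈ᵇ-refl ; hits = λ { (here refl) → p } ; keeps = id }
    ... | no new = exchange (simplify (sp u v))
      where
      u v : Fin n
      u = proj₁ (ends G (t j))
      v = proj₂ (ends G (t j))
      inT? : ∀ e → Dec (Image {n} t e)
      inT? e = any? λ i → t i ≟ e
      exchange : Σ (Walk G (Image {n} l) u v) Simpleʷ → Approach l 1 (j ∷ [])
      exchange (w , q) with All.all? inT? (edges w)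
      -- A path inside `t` would bypass `t j` and make its label spare.
      ... | yes all = ⊥-elim (no-spare-label t j λ x y → bindʷ reroute (spt x y))
        where
        rest : ∀ {e} → Image {n} t e → Image {n} l e → ∃ λ h → h ≢ j × t h ≡ e
        rest (h , refl) e∈l = h , (λ { refl → new e∈l }) , refl
        w′ : Walk G (λ e → ∃ λ h → h ≢ j × t h ≡ e) u v
        w′ = mapʷ (λ e∈ → rest (All.lookup all e∈) (edges⊆ w e∈)) (proj₁ (selfʷ w))
        reroute : ∀ {e x y} → Image {n} t e → Joins G e x y → Walk G (λ e → ∃ λ h → h ≢ j × t h ≡ e) x y
        reroute (h , refl) jn with h ≟ j
        ... | no h≢j = edgeʷ (h , h≢j , refl) jn
        ... | yes refl with Joins-unique jn (inj₁ refl)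
        ...   | inj₁ (refl , refl) = w′
        ...   | inj₂ (refl , refl) = symʷ w′
      ... | no ¬all with find (¬All⇒Any¬ inT? _ ¬all)
      ...   | f , f∈ , f∉t with edges⊆ w f∈
      ...     | i , refl = record
        { spans = sp′
        ; to    = reach-one i (λ h h≢i → relabel-miss l i (t j) h≢i) sp′
        ; from  = reach-one i (λ h h≢i → sym (relabel-miss l i (t j) h≢i)) sp
        ; close = close′
        ; hits  = λ { (here refl) → i , relabel-hit l i (t j) }
        ; keeps = λ { (h , eq) → h , trans (relabel-miss l i (t j) (λ { refl → f∉t (_ , sym eq) })) eq }
        }
        where
        sp′ : Spans (relabel l i (t j))
        sp′ = patch-connected sp id (closed-Patch w q (inj₁ refl) f∈) (Image {n} (relabel l i (t j)))
          (λ { (h , refl) ≢f → h , relabel-miss l i (t j) (λ { refl → ≢f refl }) })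
          (i , relabel-hit l i (t j))
        close′ : ∀ h → l h ≈ᵇ relabel l i (t j) h
        close′ h with h ≟ i
        ... | yes refl = ≈ᵇ-sym (closed-≈ᵇ w q (inj₁ refl) f∈)
        ... | no _     = ≈ᵇ-refl

    approach-list : Spans l → (js : List Label) → Approach l (length js) js
    approach-list sp [] = record
      { spans = sp ; to = reach-refl λ _ → refl ; from = reach-refl λ _ → refl
      ; close = λ _ → ≈ᵇ-refl ; hits = λ () ; keeps = id }
    approach-list {l} sp (j ∷ js) = record
      { spans = B.spans
      ; to    = reach-trans A.to B.to
      ; from  = reach-≤ (≤-reflexive (+-comm (length js) 1)) (reach-trans B.from A.from)
      ; close = λ i → ≈ᵇ-trans (A.close i) (B.close i)
      ; hits  = λ { (here refl) → B.keeps (A.hits (here refl)) ; (there p) → B.hits p }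
      ; keeps = B.keeps ∘ A.keeps
      }
      where
      module A = Approach (approach-one sp j)
      module B = Approach (approach-list A.spans js)

    approach : Spans l → Approach l (n ∸ 1) (allFin _)
    approach {l} sp = subst (λ a → Approach l a (allFin _)) (length-tabulate {n = n ∸ 1} id) (approach-list sp (allFin _))

-- Finite subsets and lists without repetition.

x∈p─q⇒x∉q : ∀ {n} {x : Fin n} (p q : Subset n) → x ∈ p ─ q → x ∉ q
x∈p─q⇒x∉q (inside ∷ p)  (outside ∷ q) here      ()
x∈p─q⇒x∉q (_ ∷ p)       (_ ∷ q)       (there x∈) (there y∈) = x∈p─q⇒x∉q p q x∈ y∈

disjoint-size : ∀ {n} (p q r : Subset n) → q ⊆ p → r ⊆ p → (∀ {x} → x ∈ q → x ∉ r) → ∣ q ∣ + ∣ r ∣ ≤ ∣ p ∣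
disjoint-size [] [] [] _ _ _ = z≤n
disjoint-size (s ∷ p) (inside ∷ q) (inside ∷ r) q⊆ r⊆ dis = contradiction here (dis here)
disjoint-size (s ∷ p) (outside ∷ q) (outside ∷ r) q⊆ r⊆ dis =
  ≤-trans (disjoint-size p q r (drop-∷-⊆ q⊆) (drop-∷-⊆ r⊆) (λ x y → dis (there x) (there y))) (∣p∣≤∣x∷p∣ s p)
disjoint-size (s ∷ p) (inside ∷ q) (outside ∷ r) q⊆ r⊆ dis with q⊆ here
... | here = s≤s (disjoint-size p q r (drop-∷-⊆ q⊆) (drop-∷-⊆ r⊆) (λ x y → dis (there x) (there y)))
disjoint-size (s ∷ p) (outside ∷ q) (inside ∷ r) q⊆ r⊆ dis with r⊆ here
... | here = ≤-trans (≤-reflexive (+-suc ∣ q ∣ ∣ r ∣))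
  (s≤s (disjoint-size p q r (drop-∷-⊆ q⊆) (drop-∷-⊆ r⊆) (λ x y → dis (there x) (there y))))

listSet : ∀ {n} → List (Fin n) → Subset n
listSet = foldr (λ x p → ⁅ x ⁆ ∪ p) ∅

∈-listSet⁺ : ∀ {n} {x : Fin n} {xs} → x ∈ᴸ xs → x ∈ listSet xs
∈-listSet⁺ {x = x} (here refl) = x∈p∪q⁺ (inj₁ (x∈⁅x⁆ x))
∈-listSet⁺ (there p)   = x∈p∪q⁺ (inj₂ (∈-listSet⁺ p))

∈-listSet⁻ : ∀ {n} {x : Fin n} xs → x ∈ listSet xs → x ∈ᴸ xs
∈-listSet⁻ []       p = contradiction p ∉⊥
∈-listSet⁻ (y ∷ xs) p with x∈p∪q⁻ ⁅ y ⁆ (listSet xs) p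
... | inj₁ q = here (x∈⁅y⁆⇒x≡y y q)
... | inj₂ q = there (∈-listSet⁻ xs q)

length≤∣listSet∣ : ∀ {n} {xs : List (Fin n)} → Unique xs → length xs ≤ ∣ listSet xs ∣
length≤∣listSet∣ [] = z≤n
length≤∣listSet∣ {xs = x ∷ xs} (x∉ ∷ u) = ≤-trans (s≤s (length≤∣listSet∣ u))
  (p⊂q⇒∣p∣<∣q∣ (q⊆p∪q ⁅ x ⁆ (listSet xs) , x , x∈p∪q⁺ (inj₁ (x∈⁅x⁆ x)) , All¬⇒¬Any x∉ ∘ ∈-listSet⁻ xs))

Unique-++⁻ : ∀ {n} (xs : List (Fin n)) {ys} → Unique (xs ++ ys) →
             Unique xs × Unique ys × (∀ {x} → x ∈ᴸ xs → x ∈ᴸ ys → ⊥)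
Unique-++⁻ []       u = [] , u , λ ()
Unique-++⁻ (x ∷ xs) (x∉ ∷ u) with Unique-++⁻ xs u
... | ux , uy , dis =
  ¬Any⇒All¬ _ (All¬⇒¬Any x∉ ∘ ∈-++⁺ˡ) ∷ ux , uy ,
  λ { (here refl) q → All¬⇒¬Any x∉ (∈-++⁺ʳ xs q) ; (there p) q → dis p q }

Unique-swap-middle : ∀ {n} (xs ms ks ys : List (Fin n)) → Unique (xs ++ ms ++ ys) → Unique ks →
                     (∀ {x} → x ∈ᴸ ks → x ∉ᴸ xs ++ ms ++ ys) → Unique (xs ++ ks ++ ys)
Unique-swap-middle xs ms ks ys u uk dis with Unique-++⁻ xs u
... | ux , umy , d₁ with Unique-++⁻ ms umy
...   | um , uy , d₂ =
  ++⁺ ux (++⁺ uk uy λ (p , q) → dis p (∈-++⁺ʳ xs (∈-++⁺ʳ ms q)))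
    λ (p , q) → [ (λ r → dis r (∈-++⁺ˡ p)) , (λ r → d₁ p (∈-++⁺ʳ ms r)) ]′ (∈-++⁻ ks q)

data FirstSplit {n} (P : Fin n → Set) (xs : List (Fin n)) : Set where
  none  : (∀ {x} → x ∈ᴸ xs → ¬ P x) → FirstSplit P xs
  first : ∀ ys x zs → xs ≡ ys ++ x ∷ zs → P x → (∀ {y} → y ∈ᴸ ys → ¬ P y) → FirstSplit P xs

first-split : ∀ {n} {P : Fin n → Set} → (∀ x → Dec (P x)) → ∀ xs → FirstSplit P xs
first-split P? [] = none λ ()
first-split P? (x ∷ xs) with P? x
... | yes p = first [] x xs refl p λ ()
... | no ¬p with first-split P? xs
...   | none h = none λ { (here refl) → ¬p ; (there q) → h q }
...   | first ys y zs refl p h = first (x ∷ ys) y zs refl p λ { (here refl) → ¬p ; (there q) → h q }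

-- Components and ears.

module Ears {n m : ℕ} (G : Graph n m) where

  open Exchange G public

  private variable
    S T : EdgeSet m
    R H K A : Subset n
    u v x y : Fin n

  Joins? : ∀ e x y → Dec (Joins G e x y)
  Joins? e x y = (≡-dec _≟_ _≟_ (ends G e) (x , y)) ⊎-dec (≡-dec _≟_ _≟_ (ends G e) (y , x))

  record Inside (R : Subset n) (e : Fin m) : Set where
    constructor allEnds
    field end∈ : ∀ {x y} → Joins G e x y → x ∈ R

  open Inside

  joins-inside : ∀ {e} → Joins G e x y → x ∈ R → y ∈ R → Inside R e
  joins-inside j p q = allEnds λ j′ → [ (λ { (refl , _) → p }) , (λ { (refl , _) → q }) ]′ (Joins-unique j′ j)

  Inside-mono : R ⊆ H → ∀ {e} → Inside R e → Inside H e
  Inside-mono R⊆H i = allEnds λ j → R⊆H (end∈ i j)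

  verts⊆ : (∀ {e} → S e → Inside R e) → (w : Walk G S u v) → u ∈ R → x ∈ᴸ verts w → x ∈ R
  verts⊆ h here           p (here refl) = p
  verts⊆ h (step e s j w) p (here refl) = p
  verts⊆ h (step e s j w) p (there q)   = verts⊆ h w (end∈ (h s) (Joins-sym j)) q

  infix 4 _~_
  _~_ : Fin n → Fin n → Set
  x ~ y = ∃ λ e → Joins G e x y

  ~-sym : x ~ y → y ~ x
  ~-sym (e , j) = e , Joins-sym j

  exit : (w : Walk G S u v) → u ∈ K → v ∉ K → ∃₂ λ x y → ∃ λ e → S e × Joins G e x y × x ∈ K × y ∉ K
  exit here u∈ v∉ = contradiction u∈ v∉
  exit {K = K} (step {u} {x} e s j w) u∈ v∉ with x ∈? K
  ... | yes x∈ = exit w x∈ v∉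
  ... | no x∉  = u , x , e , s , j , u∈ , x∉

  record Component (R H : Subset n) : Set where
    field
      ⊆R        : H ⊆ R
      connected : x ∈ H → y ∈ H → Walk G (Inside H) x y
      closed    : x ~ y → x ∈ H → y ∈ R → y ∈ H

  Component-absorbs : Component R H → K ⊆ R → Walk G (Inside K) x y → x ∈ H → y ∈ H
  Component-absorbs C K⊆R here x∈ = x∈
  Component-absorbs C K⊆R (step e i j w) x∈ =
    Component-absorbs C K⊆R w (Component.closed C (e , j) x∈ (K⊆R (end∈ i (Joins-sym j))))

  component : ∀ R {x} → x ∈ R → Σ (Subset n) λ H → Component R H × x ∈ H
  component R {x₀} x₀∈R = grow ∣ R ─ ⁅ x₀ ⁆ ∣ ⁅ x₀ ⁆
      (λ p → subst (_∈ R) (sym (x∈⁅y⁆⇒x≡y x₀ p)) x₀∈R)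
      (λ p → subst (Walk G _ x₀) (sym (x∈⁅y⁆⇒x≡y x₀ p)) here)
      (x∈⁅x⁆ x₀) ≤-refl
    where
    -- `N` bounds the number of vertices of `R` not yet absorbed, which drops with each added
    -- vertex.
    grow : ∀ N K → K ⊆ R → (∀ {y} → y ∈ K → Walk G (Inside K) x₀ y) → x₀ ∈ K → ∣ R ─ K ∣ ≤ N →
           Σ (Subset n) λ H → Component R H × x₀ ∈ H
    grow N K K⊆R con x₀∈K size
      with any? (λ x → any? (λ y → any? (λ e → Joins? e x y) ×-dec ((x ∈? K) ×-dec ((y ∈? R) ×-dec ¬? (y ∈? K)))))
    ... | no stop = K , record
      { ⊆R = K⊆R
      ; connected = λ p q → symʷ (con p) ++ʷ con q
      ; closed = λ {x} {y} x~y x∈K y∈R → case y ∈? K of λ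
          { (yes y∈K) → y∈K ; (no y∉K) → contradiction (x , y , x~y , x∈K , y∈R , y∉K) stop }
      } , x₀∈K
    ... | yes (x , y , (e , j) , x∈K , y∈R , y∉K) = next-size N size
      where
      K′ = ⁅ y ⁆ ∪ K
      K⊆K′ : K ⊆ K′
      K⊆K′ = q⊆p∪q ⁅ y ⁆ K
      y∈K′ : y ∈ K′
      y∈K′ = x∈p∪q⁺ (inj₁ (x∈⁅x⁆ y))
      smaller : ∣ R ─ K′ ∣ < ∣ R ─ K ∣
      smaller = p⊂q⇒∣p∣<∣q∣
        ((λ p → x∈p∧x∉q⇒x∈p─q (p─q⊆p R K′ p) (x∈p─q⇒x∉q R K′ p ∘ K⊆K′)) ,
         y , x∈p∧x∉q⇒x∈p─q y∈R y∉K , λ p → x∈p─q⇒x∉q R K′ p y∈K′)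
      next-size : ∀ N → ∣ R ─ K ∣ ≤ N → Σ (Subset n) λ H → Component R H × x₀ ∈ H
      next-size zero    size = contradiction smaller (≤⇒≯ (≤-trans size z≤n))
      next-size (suc N) size = grow N K′
        (λ p → [ (λ q → subst (_∈ R) (sym (x∈⁅y⁆⇒x≡y y q)) y∈R) , K⊆R ]′ (x∈p∪q⁻ ⁅ y ⁆ K p))
        (λ p → [ (λ q → subst (Walk G _ x₀) (sym (x∈⁅y⁆⇒x≡y y q))
                   (mapʷ (Inside-mono K⊆K′) (con x∈K) ++ʷ edgeʷ (joins-inside j (K⊆K′ x∈K) y∈K′) j))
               , (λ q → mapʷ (Inside-mono K⊆K′) (con q)) ]′ (x∈p∪q⁻ ⁅ y ⁆ K p))
        (K⊆K′ x₀∈K) (s≤s⁻¹ (≤-trans smaller size))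

  Neighbour : Subset n → Fin n → Set
  Neighbour H a = ∃ λ x → x ∈ H × x ~ a

  Neighbour? : ∀ H a → Dec (Neighbour H a)
  Neighbour? H a = any? (λ x → (x ∈? H) ×-dec any? (λ e → Joins? e x a))

  record TwoNeighbours (H S : Subset n) : Set where
    constructor twoNeighbours
    field
      {a b} : Fin n
      a≢b   : a ≢ b
      a∈S   : a ∈ S
      b∈S   : b ∈ S
      a-nbr : Neighbour H a
      b-nbr : Neighbour H b

  TwoNeighbours? : ∀ H S → Dec (TwoNeighbours H S)
  TwoNeighbours? H S = map′
    (λ { (a , b , ne , p , q , r , s) → twoNeighbours ne p q r s })
    (λ { (twoNeighbours ne p q r s) → _ , _ , ne , p , q , r , s })
    (any? (λ a → any? (λ b → ¬? (a ≟ b) ×-dec ((a ∈? S) ×-dec ((b ∈? S) ×-dec (Neighbour? H a ×-dec Neighbour? H b))))))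

  TwoNeighbours-mono : ∀ {S} → K ⊆ H → TwoNeighbours K S → TwoNeighbours H S
  TwoNeighbours-mono K⊆H (twoNeighbours ne p q (x , x∈ , r) (y , y∈ , s)) =
    twoNeighbours ne p q (x , K⊆H x∈ , r) (y , K⊆H y∈ , s)

  -- Only the inner vertices are stored, so that rerouting an ear is surgery on lists; `chain-walk`
  -- fixes the edges afterwards.
  Chain : Fin n → List (Fin n) → Fin n → Set
  Chain u []       v = u ~ v
  Chain u (x ∷ xs) v = u ~ x × Chain x xs v

  Chain-++⁻ : ∀ xs {ys} → Chain u (xs ++ y ∷ ys) v → Chain u xs y × Chain y ys v
  Chain-++⁻ []       c       = c
  Chain-++⁻ (x ∷ xs) (c , d) = Prod.map₁ (c ,_) (Chain-++⁻ xs d)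

  Chain-++⁺ : ∀ xs {ys} → Chain u xs y → Chain y ys v → Chain u (xs ++ y ∷ ys) v
  Chain-++⁺ []       c       d = c , d
  Chain-++⁺ (x ∷ xs) (c , e) d = c , Chain-++⁺ xs e d

  verts-Chain : (w : Walk G S u v) → x ~ u → v ~ y → Chain x (verts w) y
  verts-Chain here           p q = p , q
  verts-Chain (step e s j w) p q = p , verts-Chain w (e , j) q

  -- The end edges are kept apart from the inner walk: `e₀` will join the tree, while `g` is left
  -- out and closes the fundamental cycle.
  record ChainWalk (u : Fin n) (xs : List (Fin n)) (v : Fin n) : Set where
    field
      {x₀ y₀} : Fin n
      {e₀ g}  : Fin m
      start   : Joins G e₀ u x₀
      walk    : Walk G (λ _ → ⊤) x₀ y₀
      finish  : Joins G g v y₀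
      verts≡  : verts walk ≡ xs

  chain-walk : ∀ xs → x ∈ᴸ xs → Chain u xs v → ChainWalk u xs v
  chain-walk (x ∷ []) _ ((e , j) , (g , j′)) = record
    { start = j ; walk = here ; finish = Joins-sym j′ ; verts≡ = refl }
  chain-walk (x ∷ y ∷ ys) _ ((e , j) , c) = record
    { start = j ; walk = step C.e₀ tt C.start C.walk ; finish = C.finish ; verts≡ = cong (x ∷_) C.verts≡ }
    where module C = ChainWalk (chain-walk (y ∷ ys) (here refl) c)

  record Detour (K : Subset n) (x y : Fin n) : Set where
    field
      {ks}   : List (Fin n)
      chain  : Chain x ks y
      unique : Unique ks
      ks⊆K   : ∀ {z} → z ∈ᴸ ks → z ∈ K
      {c}    : Fin n
      c∈ks   : c ∈ᴸ ks

  detour : (∀ {x y} → x ∈ K → y ∈ K → Walk G (Inside K) x y) → Neighbour K x → Neighbour K y → Detour K x y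
  detour con (p , p∈ , p~) (q , q∈ , q~) with simplify (con p∈ q∈)
  ... | w , u = record
    { chain  = verts-Chain w (~-sym p~) q~
    ; unique = u
    ; ks⊆K   = verts⊆ (λ i → i) w p∈
    ; c∈ks   = start∈verts w
    }

  record Ear (S H : Subset n) : Set where
    field
      {a b}    : Fin n
      {ps}     : List (Fin n)
      a≢b      : a ≢ b
      a∈S      : a ∈ S
      b∈S      : b ∈ S
      chain    : Chain a ps b
      unique   : Unique ps
      ps⊆H     : ∀ {x} → x ∈ᴸ ps → x ∈ H
      {p}      : Fin n
      p∈ps     : p ∈ᴸ ps

    rest : Subset n
    rest = H ─ listSet ps

  -- Ears that leave only small components with two covered neighbours.

  module Halving {S H : Subset n} (S∩H : ∀ {x} → x ∈ S → x ∉ H)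
                 (closed : ∀ {x y} → x ~ y → x ∈ H → y ∈ H ⊎ y ∈ S)
                 (conH : ∀ {x y} → x ∈ H → y ∈ H → Walk G (Inside H) x y) where

    record Bad (E : Ear S H) (K : Subset n) : Set where
      field
        comp : Component (Ear.rest E) K
        two  : TwoNeighbours K (S ∪ listSet (Ear.ps E))
        big  : ∣ H ∣ < 2 * ∣ K ∣

    rest⁺ : (E : Ear S H) → x ∈ H → x ∉ᴸ Ear.ps E → x ∈ Ear.rest E
    rest⁺ E x∈ x∉ = x∈p∧x∉q⇒x∈p─q x∈ (x∉ ∘ ∈-listSet⁻ (Ear.ps E))

    rest⁻ : (E : Ear S H) → x ∈ Ear.rest E → x ∈ H × x ∉ᴸ Ear.ps E
    rest⁻ E x∈ = p─q⊆p H _ x∈ , x∈p─q⇒x∉q H _ x∈ ∘ ∈-listSet⁺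

    record Rerouted (E : Ear S H) (K : Subset n) : Set where
      field
        ear   : Ear S H
        {c}   : Fin n
        c∈K   : c ∈ K
        c∈ps  : c ∈ᴸ Ear.ps ear
        keeps : ∀ {x} → x ∈ᴸ Ear.ps E → Neighbour K x → x ∈ᴸ Ear.ps ear

    -- The discarded stretch `ms` contains no neighbour of `K`, which gives `keeps`; the detour
    -- avoids the old ear because `K` does.
    splice : (E : Ear S H) → ∀ {K} → Bad E K → ∀ {x y a′ b′} → a′ ≢ b′ → a′ ∈ S → b′ ∈ S →
             (D : Detour K x y) → ∀ xs ms ys → Ear.ps E ≡ xs ++ ms ++ ys →
             Chain a′ (xs ++ Detour.ks D ++ ys) b′ → (∀ {z} → z ∈ᴸ ms → ¬ Neighbour K z) → Rerouted E K
    splice E {K} B a≢b a∈ b∈ D xs ms ys refl new free = record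
      { ear = record
        { a≢b = a≢b ; a∈S = a∈ ; b∈S = b∈ ; chain = new
        ; unique = Unique-swap-middle xs ms ks ys E.unique unique (λ p → proj₂ (K⊆ p))
        ; ps⊆H = λ p → [ (λ q → E.ps⊆H (∈-++⁺ˡ q))
                       , [ (λ q → proj₁ (K⊆ q)) , (λ q → E.ps⊆H (∈-++⁺ʳ xs (∈-++⁺ʳ ms q))) ]′ ∘ ∈-++⁻ ks
                       ]′ (∈-++⁻ xs p)
        ; p∈ps = k∈
        }
      ; c∈K = ks⊆K c∈ks
      ; c∈ps = k∈
      ; keeps = λ p nb → [ (λ q → ∈-++⁺ˡ q)
                         , [ (λ q → contradiction nb (free q)) , (λ q → ∈-++⁺ʳ xs (∈-++⁺ʳ ks q)) ]′ ∘ ∈-++⁻ ms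
                         ]′ (∈-++⁻ xs p)
      }
      where
      module E = Ear E
      open Detour D
      K⊆ : ∀ {z} → z ∈ᴸ ks → z ∈ H × z ∉ᴸ E.ps
      K⊆ = rest⁻ E ∘ Component.⊆R (Bad.comp B) ∘ ks⊆K
      k∈ : _ ∈ᴸ xs ++ ks ++ ys
      k∈ = ∈-++⁺ʳ xs (∈-++⁺ˡ c∈ks)

    -- The ear is rerouted through K between two consecutive neighbours of K; if K has
    -- only one neighbour on the ear, K serves as a new way to or from S.
    reroute : (E : Ear S H) → ∀ {K} → Bad E K → Rerouted E K
    reroute E {K} B with first-split (Neighbour? K) (Ear.ps E)
    -- `H` is connected, so a walk from `K` to the ear leaves `K`; the vertex reached must lie on
    -- the ear, or it would belong to the component `K`.
    ... | none h = contradiction (proj₂ on-ear) (h (proj₁ on-ear))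
      where
      open Ear E
      open Bad B
      K⊆ : ∀ {z} → z ∈ K → z ∈ H × z ∉ᴸ ps
      K⊆ = rest⁻ E ∘ Component.⊆R comp
      c∈K = proj₁ (proj₂ (TwoNeighbours.a-nbr two))
      leaves-through-ear : (∃₂ λ x y → ∃ λ e → Inside H e × Joins G e x y × x ∈ K × y ∉ K) →
                           ∃ λ y → y ∈ᴸ ps × Neighbour K y
      leaves-through-ear (x , y , e , i , j , x∈K , y∉K) with ∈ᴸ-dec _≟_ y ps
      ... | yes y∈ps = y , y∈ps , x , x∈K , e , j
      ... | no y∉ps  = contradiction (Component.closed comp (e , j) x∈K (rest⁺ E (end∈ i (Joins-sym j)) y∉ps)) y∉K
      on-ear = proj₂ (leaves-through-ear
        (exit (conH (proj₁ (K⊆ c∈K)) (ps⊆H p∈ps)) c∈K (λ p∈K → proj₂ (K⊆ p∈K) p∈ps)))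
    ... | first ys x zs refl nx no-ys with first-split (Neighbour? K) zs
    ...   | first ms y ws refl ny no-ms =
      splice E B a≢b a∈S b∈S D (ys ++ x ∷ []) ms (y ∷ ws) (sym (++-assoc ys (x ∷ []) _))
        (subst (λ l → Chain a l b) (sym (++-assoc ys (x ∷ []) _))
          (Chain-++⁺ ys (proj₁ parts) (Chain-++⁺ (Detour.ks D) (Detour.chain D) (proj₂ (Chain-++⁻ ms (proj₂ parts))))))
        no-ms
      where
      open Ear E
      parts = Chain-++⁻ ys chain
      D = detour (Component.connected (Bad.comp B)) nx ny
    -- `x` is the only neighbour of `K` on the ear, so a second covered neighbour of `K` lies in
    -- `S`.
    ...   | none no-zs = branch (other (Bad.two B))
      where
      open Ear E
      parts = Chain-++⁻ ys chain
      outside-ear : ∀ {z} → z ≢ x → z ∈ S ∪ listSet ps → Neighbour K z → z ∈ S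
      outside-ear {z} z≢x z∈ nz with x∈p∪q⁻ S _ z∈
      ... | inj₁ z∈S = z∈S
      ... | inj₂ z∈P with ∈-++⁻ ys (∈-listSet⁻ ps z∈P)
      ...   | inj₁ z∈ys          = contradiction nz (no-ys z∈ys)
      ...   | inj₂ (here z≡x)    = contradiction z≡x z≢x
      ...   | inj₂ (there z∈zs)  = contradiction nz (no-zs z∈zs)
      other : TwoNeighbours K (S ∪ listSet ps) → ∃ λ y → y ∈ S × Neighbour K y
      other (twoNeighbours {a′} {b′} ne a∈ b∈ na nb) with a′ ≟ x
      ... | yes refl = b′ , outside-ear (ne ∘ sym) b∈ nb , nb
      ... | no a′≢x  = a′ , outside-ear a′≢x a∈ na , na
      branch : (∃ λ y → y ∈ S × Neighbour K y) → Rerouted E K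
      -- The ends must stay distinct: if `y` is not `a`, the part up to `x` is kept and the ear
      -- leaves to `y`; otherwise it enters through `K` and keeps the part from `x` to `b`.
      branch (y , y∈S , ny) with a ≟ y
      ... | no a≢y =
        splice E B a≢y a∈S y∈S D (ys ++ x ∷ []) zs []
          (trans (sym (++-assoc ys (x ∷ []) zs)) (cong ((ys ++ x ∷ []) ++_) (sym (++-identityʳ zs))))
          (subst (λ l → Chain a l y)
            (trans (sym (++-assoc ys (x ∷ []) _)) (cong ((ys ++ x ∷ []) ++_) (sym (++-identityʳ _))))
            (Chain-++⁺ ys (proj₁ parts) (Detour.chain D)))
          no-zs
        where D = detour (Component.connected (Bad.comp B)) nx ny
      ... | yes refl =
        splice E B a≢b a∈S b∈S D [] ys (x ∷ zs) refl
          (Chain-++⁺ (Detour.ks D) (Detour.chain D) (proj₂ parts)) no-ys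
        where D = detour (Component.connected (Bad.comp B)) ny nx

    big-meet : K ⊆ H → A ⊆ H → ∣ H ∣ < 2 * ∣ K ∣ → ∣ H ∣ < 2 * ∣ A ∣ → ∃ λ z → z ∈ K × z ∈ A
    big-meet {K} {A} K⊆ A⊆ bK bA with any? (λ z → (z ∈? K) ×-dec (z ∈? A))
    ... | yes z = z
    ... | no ¬z = contradiction
      (<-≤-trans (+-mono-< bK bA)
        (≤-trans (≤-reflexive (sym (*-distribˡ-+ 2 ∣ K ∣ ∣ A ∣)))
          (≤-trans (*-monoʳ-≤ 2 (disjoint-size H K A K⊆ A⊆ (λ p q → ¬z (_ , p , q))))
            (≤-reflexive (cong (∣ H ∣ +_) (+-identityʳ ∣ H ∣))))))
      (≤⇒≯ ≤-refl)

    -- Both bad components are larger than half of H, so they meet; since the new ear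
    -- keeps all the neighbours of K on the old one, A cannot leave K.
    rerouted-shrinks : {E : Ear S H} → Bad E K → (E′ : Rerouted E K) → Bad (Rerouted.ear E′) A → ∣ A ∣ < ∣ K ∣
    rerouted-shrinks {K} {A} {E} B E′ B′ = p⊂q⇒∣p∣<∣q∣ (A⊆K , _ , c∈K , λ c∈A → proj₂ (A⊆ c∈A) c∈ps)
      where
      open Rerouted E′
      module C = Component (Bad.comp B)
      module C′ = Component (Bad.comp B′)
      K⊆ : ∀ {z} → z ∈ K → z ∈ H × z ∉ᴸ Ear.ps E
      K⊆ = rest⁻ E ∘ C.⊆R
      A⊆ : ∀ {z} → z ∈ A → z ∈ H × z ∉ᴸ Ear.ps ear
      A⊆ = rest⁻ ear ∘ C′.⊆R
      stay : ∀ {x y} → Walk G (Inside A) x y → x ∈ K → y ∈ K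
      stay here x∈K = x∈K
      stay (step {u} {x} e i j w) u∈K = stay w (x∈K (∈ᴸ-dec _≟_ x (Ear.ps E)))
        where
        x∈A = A⊆ (end∈ i (Joins-sym j))
        x∈K : Dec (x ∈ᴸ Ear.ps E) → x ∈ K
        x∈K (yes x∈) = contradiction (keeps x∈ (u , u∈K , e , j)) (proj₂ x∈A)
        x∈K (no x∉)  = C.closed (e , j) u∈K (rest⁺ E (proj₁ x∈A) x∉)
      common = big-meet (proj₁ ∘ K⊆) (proj₁ ∘ A⊆) (Bad.big B) (Bad.big B′)
      A⊆K : A ⊆ K
      A⊆K y∈A = stay (C′.connected (proj₂ (proj₂ common)) y∈A) (proj₁ (proj₂ common))

    -- It suffices to test one component per vertex: a bad set containing `x` lies in the computed
    -- component of `x`, which inherits both the two neighbours and the size.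
    bad? : (E : Ear S H) → Dec (∃ (Bad E))
    bad? E = map′ (λ { (x , K , B , _) → K , B })
      (λ { (K , B) → let x , x∈K , _ = TwoNeighbours.a-nbr (Bad.two B) in x , K , B , x∈K })
      (any? bad-at?)
      where
      bad-at? : ∀ x → Dec (∃ λ K → Bad E K × x ∈ K)
      bad-at? x with x ∈? Ear.rest E
      ... | no x∉  = no λ { (K , B , x∈K) → x∉ (Component.⊆R (Bad.comp B) x∈K) }
      ... | yes x∈ with component (Ear.rest E) x∈
      ...   | K , C , x∈K = map′
        (λ { (two , big) → K , record { comp = C ; two = two ; big = big } , x∈K })
        (λ { (A , B , x∈A) →
          let A⊆K : A ⊆ K
              A⊆K y∈A = Component-absorbs C (Component.⊆R (Bad.comp B)) (Component.connected (Bad.comp B) x∈A y∈A) x∈K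
          in TwoNeighbours-mono A⊆K (Bad.two B) , <-≤-trans (Bad.big B) (*-monoʳ-≤ 2 (p⊆q⇒∣p∣≤∣q∣ A⊆K)) })
        (TwoNeighbours? K (S ∪ listSet (Ear.ps E)) ×-dec (∣ H ∣ <? 2 * ∣ K ∣))

    halving-ear : TwoNeighbours H S → Σ (Ear S H) λ E → ∀ {K} → ¬ Bad E K
    halving-ear (twoNeighbours ne p q r s) = decide ∣ H ∣ E₀ λ {K} B →
      p⊆q⇒∣p∣≤∣q∣ (proj₁ ∘ rest⁻ E₀ ∘ Component.⊆R (Bad.comp B))
      where
      D = detour conH r s
      E₀ : Ear S H
      E₀ = record { a≢b = ne ; a∈S = p ; b∈S = q ; chain = Detour.chain D ; unique = Detour.unique D
                  ; ps⊆H = Detour.ks⊆K D ; p∈ps = Detour.c∈ks D }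
      -- `N` bounds every bad component of the current ear; a rerouting makes all of them smaller
      -- than the one just treated.
      decide : ∀ N (E : Ear S H) → (∀ {K} → Bad E K → ∣ K ∣ ≤ N) → Σ (Ear S H) λ E → ∀ {K} → ¬ Bad E K
      decide N E bound with bad? E
      ... | no good = E , λ {K} B → good (K , B)
      decide zero E bound | yes (K , B) =
        contradiction (Bad.big B) (≤⇒≯ (≤-trans (*-monoʳ-≤ 2 (bound B)) z≤n))
      decide (suc N) E bound | yes (K , B) =
        decide N (Rerouted.ear E′) λ B′ → s≤s⁻¹ (≤-trans (rerouted-shrinks B E′ B′) (bound B))
        where E′ = reroute E B

-- Growing the tree ear by ear.

module Growth {n m : ℕ} (G : Graph n m) (whole : Connected G (λ _ → ⊤)) (D : ℕ) (n≤2^D : n ≤ 2 ^ D) where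

  open Ears G public
  open Inside

  private variable
    T T′      : EdgeSet m
    F         : List (Fin m)
    R R′ H S  : Subset n
    e f r     : Fin m
    d t       : ℕ

  -- In the second case e is separated from every edge that does not touch R.
  Anchored : EdgeSet m → Subset n → Fin m → Fin m → Set
  Anchored T R r e = Dist T D e r ⊎ ∃₂ λ a K → HangsAt a K × K ⊆ R × Touches K e

  Separated : Fin m → Fin m → Set
  Separated e f = ∃₂ λ a K → HangsAt a K × (Touches K e × ¬ Touches K f ⊎ ¬ Touches K e × Touches K f)

  -- The detour through a common starting edge costs `D` on each side. A separation refutes `_≈ᵇ_`.
  Resolved : EdgeSet m → Fin m → Fin m → Set
  Resolved T e f = Dist T (D + D) e f ⊎ Separated e f

  Touches-mono : R ⊆ R′ → Touches R e → Touches R′ e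
  Touches-mono R⊆ (x , y , j , p) = x , y , j , R⊆ p

  Anchored-mono : (∀ {e} → T e → T′ e) → R ⊆ R′ → Anchored T R r e → Anchored T′ R′ r e
  Anchored-mono h R⊆ (inj₁ x)                 = inj₁ (Dist-mono h x)
  Anchored-mono h R⊆ (inj₂ (a , K , s , p , q)) = inj₂ (a , K , s , R⊆ ∘ p , q)

  Resolved-mono : (∀ {e} → T e → T′ e) → Resolved T e f → Resolved T′ e f
  Resolved-mono h (inj₁ x) = inj₁ (Dist-mono h x)
  Resolved-mono h (inj₂ s) = inj₂ s

  Resolved-sym : T e → Resolved T e f → Resolved T f e
  Resolved-sym t (inj₁ x)                    = inj₁ (Dist-sym t x)
  Resolved-sym t (inj₂ (a , K , s , inj₁ (x , y))) = inj₂ (a , K , s , inj₂ (y , x))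
  Resolved-sym t (inj₂ (a , K , s , inj₂ (x , y))) = inj₂ (a , K , s , inj₁ (y , x))

  -- If one edge hangs in some `K` that the other does not touch, `K` separates them; otherwise both
  -- are within `D` of `r`.
  resolve : T f → Anchored T R r e → Anchored T R′ r f → ¬ Touches R f → ¬ Touches R′ e → Resolved T e f
  resolve tf (inj₂ (a , K , s , K⊆ , te)) _ ¬f _ = inj₂ (a , K , s , inj₁ (te , ¬f ∘ Touches-mono K⊆))
  resolve tf (inj₁ _) (inj₂ (a , K , s , K⊆ , tf′)) _ ¬e = inj₂ (a , K , s , inj₂ (¬e ∘ Touches-mono K⊆ , tf′))
  resolve tf (inj₁ x) (inj₁ y) _ _ = inj₁ (Dist-trans x (Dist-sym tf y))

  -- `size` stands in for acyclicity: in the end at most n - 1 edges connect n vertices, which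
  -- forces a tree.
  record Grown (R S : Subset n) (F : List (Fin m)) (r : Fin m) : Set where
    field
      new      : List (Fin m)
      size     : length new ≤ ∣ R ∣
      spans    : ∀ {x} → x ∈ R → ∃ λ s → s ∈ S × Walk G (_∈ᴸ new ++ F) x s
      touches  : e ∈ᴸ new → Touches R e
      anchored : e ∈ᴸ new → Anchored (_∈ᴸ new ++ F) R r e
      resolved : e ∈ᴸ new → f ∈ᴸ new → Resolved (_∈ᴸ new ++ F) e f

  grown-empty : ¬ Nonempty R → Grown R S F r
  grown-empty empty = record
    { new = [] ; size = z≤n ; spans = λ p → contradiction (_ , p) empty
    ; touches = λ () ; anchored = λ () ; resolved = λ () }

  -- Both parts grow from the same trunk. No edge touches both, so `resolve` settles the mixed
  -- pairs.
  grown-glue : Component R H → Grown H S F r → Grown (R ─ H) S F r → Grown R S F r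
  grown-glue {R} {H} {S} {F} C A B = record
    { new = A.new ++ B.new
    ; size = ≤-trans (≤-reflexive (length-++ A.new))
        (≤-trans (+-mono-≤ A.size B.size)
          (disjoint-size R H (R ─ H) C.⊆R (p─q⊆p R H) (λ p q → x∈p─q⇒x∉q R H q p)))
    ; spans = spans
    ; touches = λ p → [ Touches-mono C.⊆R ∘ A.touches , Touches-mono (p─q⊆p R H) ∘ B.touches ]′ (∈-++⁻ A.new p)
    ; anchored = λ p → [ Anchored-mono inA C.⊆R ∘ A.anchored , Anchored-mono inB (p─q⊆p R H) ∘ B.anchored ]′ (∈-++⁻ A.new p)
    ; resolved = λ p q → resolved (∈-++⁻ A.new p) (∈-++⁻ A.new q)
    }
    where
    module A = Grown A
    module B = Grown B
    module C = Component C
    AllEdges : EdgeSet m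
    AllEdges = _∈ᴸ (A.new ++ B.new) ++ F
    inA : ∀ {e} → e ∈ᴸ A.new ++ F → AllEdges e
    inA p = [ ∈-++⁺ˡ ∘ ∈-++⁺ˡ , ∈-++⁺ʳ (A.new ++ B.new) ]′ (∈-++⁻ A.new p)
    inB : ∀ {e} → e ∈ᴸ B.new ++ F → AllEdges e
    inB p = [ ∈-++⁺ˡ ∘ ∈-++⁺ʳ A.new , ∈-++⁺ʳ (A.new ++ B.new) ]′ (∈-++⁻ B.new p)
    spans : ∀ {x} → x ∈ R → ∃ λ s → s ∈ S × Walk G AllEdges x s
    spans {x} x∈ with x ∈? H
    ... | yes x∈H = let s , s∈ , w = A.spans x∈H in s , s∈ , mapʷ inA w
    ... | no x∉H  = let s , s∈ , w = B.spans (x∈p∧x∉q⇒x∈p─q x∈ x∉H) in s , s∈ , mapʷ inB w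
    apart : ∀ {e} → Touches H e → ¬ Touches (R ─ H) e
    apart tH (x , y , j , x∈) with Touches-end tH j
    ... | inj₁ x∈H = x∈p─q⇒x∉q R H x∈ x∈H
    ... | inj₂ y∈H = x∈p─q⇒x∉q R H x∈ (C.closed (_ , Joins-sym j) y∈H (p─q⊆p R H x∈))
    cross : ∀ {e f} → e ∈ᴸ A.new → f ∈ᴸ B.new → Resolved AllEdges e f
    cross p q = resolve (inB (∈-++⁺ˡ q)) (Anchored-mono inA id (A.anchored p)) (Anchored-mono inB id (B.anchored q))
      (λ t → apart t (B.touches q)) (apart (A.touches p))
    resolved : ∀ {e f} → e ∈ᴸ A.new ⊎ e ∈ᴸ B.new → f ∈ᴸ A.new ⊎ f ∈ᴸ B.new → Resolved AllEdges e f
    resolved (inj₁ p) (inj₁ q) = Resolved-mono inA (A.resolved p q)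
    resolved (inj₂ p) (inj₂ q) = Resolved-mono inB (B.resolved p q)
    resolved (inj₁ p) (inj₂ q) = cross p q
    resolved (inj₂ p) (inj₁ q) = Resolved-sym (inA (∈-++⁺ˡ q)) (cross q p)

  -- Edges E are laid inside H first; the rest R of H is then grown from F₀ ++ E.
  grown-extend : ∀ {S₁ F₀ r₁} (E : List (Fin m)) → R ⊆ H → (∀ {e} → e ∈ᴸ F₀ → e ∈ᴸ F) →
    (∀ {x} → x ∈ H → x ∈ R ⊎ x ∈ S₁) →
    (∀ {x} → x ∈ S₁ → ∃ λ s → s ∈ S × Walk G (_∈ᴸ E ++ F₀) x s) →
    length E + ∣ R ∣ ≤ ∣ H ∣ →
    (∀ {e} → e ∈ᴸ E → Touches H e × ¬ Touches R e) →
    (∀ {e} → e ∈ᴸ E → Dist (_∈ᴸ E ++ F₀) D e r₁) →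
    (∀ {T e} → Touches H e → Anchored T R r₁ e → Anchored T H r e) →
    Grown R S₁ (E ++ F₀) r₁ → Grown H S F r
  grown-extend {R} {H} {F} {S} {r} {S₁} {F₀} {r₁} E R⊆H F₀⊆F cover root size touchE nearE convert A = record
    { new = A.new ++ E
    ; size = ≤-trans (≤-reflexive (trans (length-++ A.new) (+-comm (length A.new) (length E))))
        (≤-trans (+-monoʳ-≤ (length E) A.size) size)
    ; spans = λ x∈ → [ fromR , fromS₁ ]′ (cover x∈)
    ; touches = λ p → touches (∈-++⁻ A.new p)
    ; anchored = λ p → convert (touches (∈-++⁻ A.new p)) (anchored₁ (∈-++⁻ A.new p))
    ; resolved = λ p q → resolved (∈-++⁻ A.new p) (∈-++⁻ A.new q)
    }
    where
    module A = Grown A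
    AllEdges : EdgeSet m
    AllEdges = _∈ᴸ (A.new ++ E) ++ F
    inE : ∀ {e} → e ∈ᴸ E ++ F₀ → AllEdges e
    inE p = [ ∈-++⁺ˡ ∘ ∈-++⁺ʳ A.new , ∈-++⁺ʳ (A.new ++ E) ∘ F₀⊆F ]′ (∈-++⁻ E p)
    inA : ∀ {e} → e ∈ᴸ A.new ++ E ++ F₀ → AllEdges e
    inA p = [ ∈-++⁺ˡ ∘ ∈-++⁺ˡ , inE ]′ (∈-++⁻ A.new p)
    fromS₁ : ∀ {x} → x ∈ S₁ → ∃ λ s → s ∈ S × Walk G AllEdges x s
    fromS₁ x∈ = let s , s∈ , w = root x∈ in s , s∈ , mapʷ inE w
    fromR : ∀ {x} → x ∈ R → ∃ λ s → s ∈ S × Walk G AllEdges x s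
    fromR x∈ =
      let s₁ , s₁∈ , w = A.spans x∈
          s , s∈ , w′ = fromS₁ s₁∈
      in s , s∈ , mapʷ inA w ++ʷ w′
    touches : ∀ {e} → e ∈ᴸ A.new ⊎ e ∈ᴸ E → Touches H e
    touches = [ Touches-mono R⊆H ∘ A.touches , proj₁ ∘ touchE ]′
    anchored₁ : ∀ {e} → e ∈ᴸ A.new ⊎ e ∈ᴸ E → Anchored AllEdges R r₁ e
    anchored₁ (inj₁ p) = Anchored-mono inA id (A.anchored p)
    anchored₁ (inj₂ p) = inj₁ (Dist-mono inE (nearE p))
    cross : ∀ {e f} → e ∈ᴸ A.new → f ∈ᴸ E → Resolved AllEdges e f
    -- Edges of `E` are anchored by distance, which fits any `R′`; the empty set is touched by no
    -- edge.
    cross p q = resolve {R′ = ∅} (inE (∈-++⁺ˡ q)) (anchored₁ (inj₁ p)) (inj₁ (Dist-mono inE (nearE q)))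
      (proj₂ (touchE q)) λ { (_ , _ , _ , x∈) → ∉⊥ x∈ }
    resolved : ∀ {e f} → e ∈ᴸ A.new ⊎ e ∈ᴸ E → f ∈ᴸ A.new ⊎ f ∈ᴸ E → Resolved AllEdges e f
    resolved (inj₁ p) (inj₁ q) = Resolved-mono inA (A.resolved p q)
    resolved (inj₁ p) (inj₂ q) = cross p q
    resolved (inj₂ p) (inj₁ q) = Resolved-sym (inA (∈-++⁺ˡ q)) (cross q p)
    resolved (inj₂ p) (inj₂ q) =
      inj₁ (Dist-trans (Dist-mono inE (nearE p)) (Dist-sym (inE (∈-++⁺ˡ q)) (Dist-mono inE (nearE q))))

  record Trunk (S : Subset n) (F : List (Fin m)) (r : Fin m) (d : ℕ) : Set where
    field
      within    : e ∈ᴸ F → Inside S e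
      connected : ∀ {x y} → x ∈ S → y ∈ S → Walk G (_∈ᴸ F) x y
      near      : e ∈ᴸ F → Dist (_∈ᴸ F) d e r

  module EarGrowth (tr : Trunk S F r d) (S∩H : ∀ {x} → x ∈ S → x ∉ H) (E : Ear S H) where
    open Ear E
    module Tr = Trunk tr

    open ChainWalk (chain-walk ps p∈ps chain)
      renaming (start to j₀; walk to w₀; finish to jg; verts≡ to verts-w₀)

    earEdges : List (Fin m)
    earEdges = e₀ ∷ edges w₀

    S₁ : Subset n
    S₁ = S ∪ listSet ps

    F₁ : List (Fin m)
    F₁ = earEdges ++ F

    length-earEdges : length earEdges ≡ length ps
    length-earEdges = trans (sym (length-verts w₀)) (cong length verts-w₀)

    private
      w₀⊆ : ∀ {x} → x ∈ᴸ verts w₀ → x ∈ᴸ ps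
      w₀⊆ = subst (_ ∈ᴸ_) verts-w₀

    S⊆S₁ : S ⊆ S₁
    S⊆S₁ = p⊆p∪q (listSet ps)

    ps⊆S₁ : ∀ {x} → x ∈ᴸ ps → x ∈ S₁
    ps⊆S₁ p = x∈p∪q⁺ (inj₂ (∈-listSet⁺ p))

    earEdge-ends : e ∈ᴸ earEdges → ∃₂ λ x y → Joins G e x y × x ∈ S₁ × y ∈ᴸ ps
    earEdge-ends (here refl) = a , x₀ , j₀ , S⊆S₁ a∈S , w₀⊆ (start∈verts w₀)
    earEdge-ends {e} (there p) =
      _ , _ , inj₁ refl , ps⊆S₁ (w₀⊆ (ends∈verts w₀ p (inj₁ refl))) , w₀⊆ (ends∈verts w₀ p (inj₂ refl))

    reach-ear : ∀ {x} → x ∈ᴸ ps → Walk G (_∈ᴸ F₁) a x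
    reach-ear p = step e₀ (here refl) j₀ (mapʷ (there ∘ ∈-++⁺ˡ) (prefixʷ w₀ (subst (_ ∈ᴸ_) (sym verts-w₀) p)))

    root : ∀ {x} → x ∈ S₁ → ∃ λ s → s ∈ S × Walk G (_∈ᴸ F₁) x s
    root x∈ with x∈p∪q⁻ S (listSet ps) x∈
    ... | inj₁ x∈S = _ , x∈S , here
    ... | inj₂ x∈P = a , a∈S , symʷ (reach-ear (∈-listSet⁻ ps x∈P))

    trunk-path : Σ (Walk G (_∈ᴸ F) b a) Simpleʷ
    trunk-path = simplify (Tr.connected b∈S a∈S)

    toEar : Walk G (_∈ᴸ F₁) b a
    toEar = mapʷ (∈-++⁺ʳ earEdges) (proj₁ trunk-path)

    alongEar : Walk G (_∈ᴸ F₁) x₀ y₀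
    alongEar = mapʷ (there ∘ ∈-++⁺ˡ) (proj₁ (selfʷ w₀))

    -- The cycle through the ear and the trunk, without its closing edge g.
    round : Walk G (_∈ᴸ F₁) b y₀
    round = toEar ++ʷ step e₀ (here refl) j₀ alongEar

    verts-round : verts round ≡ verts (proj₁ trunk-path) ++ ps
    verts-round = trans (verts-++ toEar (here refl) j₀ alongEar)
      (cong₂ _++_ (verts-map _ (proj₁ trunk-path))
        (trans (verts-map _ (proj₁ (selfʷ w₀))) (trans (proj₂ (selfʷ w₀)) verts-w₀)))

    simple-round : Simpleʷ round
    simple-round = subst Unique (sym verts-round) (++⁺ (proj₂ trunk-path) unique
      λ (p , q) → S∩H (verts⊆ Tr.within (proj₁ trunk-path) b∈S p) (ps⊆H q))

    trunk-edge : ∃ λ f → f ∈ᴸ edges (proj₁ trunk-path)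
    trunk-edge = first-edge (proj₁ trunk-path) (a≢b ∘ sym)

    f₀∈round : proj₁ trunk-edge ∈ᴸ edges round
    f₀∈round = ∈edges-++⁺ˡ toEar _ (∈edges-map _ (proj₁ trunk-path) (proj₂ trunk-edge))

    earEdge∈round : e ∈ᴸ earEdges → e ∈ᴸ edges round
    earEdge∈round p = ∈edges-++⁺ʳ toEar _ (later p)
      where
      later : e ∈ᴸ earEdges → e ∈ᴸ e₀ ∷ edges alongEar
      later (here refl) = here refl
      later (there p)   = there (∈edges-map _ (proj₁ (selfʷ w₀)) (∈edges-self w₀ p))

    -- Since the ends `a` and `b` differ, the cycle closed by `g` contains a trunk edge, and every
    -- ear edge is adjacent to it.
    near₁ : e ∈ᴸ F₁ → Dist (_∈ᴸ F₁) (suc d) e r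
    near₁ p with ∈-++⁻ earEdges p
    ... | inj₂ q = Dist-≤ (n≤1+n d) (Dist-mono (∈-++⁺ʳ earEdges) (Tr.near q))
    ... | inj₁ q = cons (g , closed-Patch round simple-round jg (earEdge∈round q)
                           , closed-Patch round simple-round jg f₀∈round)
                        (∈-++⁺ʳ earEdges f₀∈F) (Dist-mono (∈-++⁺ʳ earEdges) (Tr.near f₀∈F))
      where f₀∈F = edges⊆ (proj₁ trunk-path) (proj₂ trunk-edge)

    trunk : Trunk S₁ F₁ r (suc d)
    trunk = record
      { within = λ p → [ (λ q → let _ , _ , j , x∈ , y∈ = earEdge-ends q in joins-inside j x∈ (ps⊆S₁ y∈))
                       , (λ q → Inside-mono S⊆S₁ (Tr.within q)) ]′ (∈-++⁻ earEdges p)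
      ; connected = λ p q →
          let s , s∈ , w = root p ; s′ , s′∈ , w′ = root q
          in w ++ʷ mapʷ (∈-++⁺ʳ earEdges) (Tr.connected s∈ s′∈) ++ʷ symʷ w′
      ; near = near₁
      }

  Component-restrict : Component R H → ∀ {K} → Component (R ─ H) K → Component R K
  Component-restrict {R} {H} C {K} C′ = record
    { ⊆R = p─q⊆p R H ∘ C′.⊆R
    ; connected = C′.connected
    ; closed = closed
    }
    where
    module C = Component C
    module C′ = Component C′
    closed : ∀ {x y} → x ~ y → x ∈ K → y ∈ R → y ∈ K
    closed {x} {y} x~y x∈K y∈R with y ∈? H
    ... | no y∉H  = C′.closed x~y x∈K (x∈p∧x∉q⇒x∈p─q y∈R y∉H)
    ... | yes y∈H = contradiction (C.closed (~-sym x~y) y∈H (p─q⊆p R H (C′.⊆R x∈K))) (x∈p─q⇒x∉q R H (C′.⊆R x∈K))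

  missing-size : ∀ {x} → R′ ⊆ R → x ∈ R → x ∉ R′ → ∣ R′ ∣ < ∣ R ∣
  missing-size R′⊆R x∈ x∉ = p⊂q⇒∣p∣<∣q∣ (R′⊆R , _ , x∈ , x∉)

  -- `t` is the number of halvings still available. Components with fewer than two neighbours in `S`
  -- need no bound, as they restart.
  record Frontier (R S : Subset n) (t : ℕ) : Set where
    field
      disjoint : ∀ {x} → x ∈ S → x ∉ R
      closed   : ∀ {x y} → x ~ y → x ∈ R → y ∈ R ⊎ y ∈ S
      {s}      : Fin n
      s∈S      : s ∈ S
      bound    : ∀ {H} → Component R H → TwoNeighbours H S → ∣ H ∣ < 2 ^ t

  Frontier-restrict : Component R H → Frontier R S t → Frontier (R ─ H) S t
  Frontier-restrict {R} {H} {S} C fr = record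
    { disjoint = λ p q → disjoint p (p─q⊆p R H q)
    ; closed = closed′
    ; s∈S = s∈S
    ; bound = bound ∘ Component-restrict C
    }
    where
    open Frontier fr
    module C = Component C
    closed′ : ∀ {x y} → x ~ y → x ∈ R ─ H → y ∈ R ─ H ⊎ y ∈ S
    closed′ {x} {y} x~y x∈ with closed x~y (p─q⊆p R H x∈)
    ... | inj₂ y∈S = inj₂ y∈S
    ... | inj₁ y∈R with y ∈? H
    ...   | no y∉H  = inj₁ (x∈p∧x∉q⇒x∈p─q y∈R y∉H)
    ...   | yes y∈H = contradiction (C.closed (~-sym x~y) y∈H (p─q⊆p R H x∈)) (x∈p─q⇒x∉q R H x∈)

  Frontier-component : Component R H → Frontier R S t → ∀ {x y} → x ~ y → x ∈ H → y ∈ H ⊎ y ∈ S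
  Frontier-component C fr x~y x∈ with Frontier.closed fr x~y (Component.⊆R C x∈)
  ... | inj₁ y∈R = inj₁ (Component.closed C x~y x∈ y∈R)
  ... | inj₂ y∈S = inj₂ y∈S

  -- `N` makes the recursion terminate, as every call drops a vertex. An ear raises `d` and lowers
  -- `t` by one, preserving their sum.
  grow : ∀ N → ∣ R ∣ ≤ N → d + t ≤ D → Trunk S F r d → Frontier R S t → Grown R S F r
  grow {R} N size d+t≤D tr fr with nonempty? R
  ... | no empty = grown-empty empty
  grow {R} zero size d+t≤D tr fr | yes (x , x∈R) =
    contradiction (x∈p⇒∣p-x∣<∣p∣ x∈R) (≤⇒≯ (≤-trans size z≤n))
  grow {R} {d} {t} {S} {F} {r} (suc N) size d+t≤D tr fr | yes (x , x∈R) with component R x∈R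
  ... | H , C , x∈H = grown-glue C (grow-component (TwoNeighbours? H S))
          (grow N (s≤s⁻¹ (≤-trans (missing-size (p─q⊆p R H) x∈R (λ p → x∈p─q⇒x∉q R H p x∈H)) size))
            d+t≤D tr (Frontier-restrict C fr))
    where
    open Frontier fr
    module C = Component C
    H∩S : ∀ {x} → x ∈ S → x ∉ H
    H∩S x∈S x∈H = disjoint x∈S (C.⊆R x∈H)
    closedH : ∀ {x y} → x ~ y → x ∈ H → y ∈ H ⊎ y ∈ S
    closedH = Frontier-component C fr

    grow-ear : ∀ t → d + t ≤ D → ∣ H ∣ < 2 ^ t → TwoNeighbours H S → Grown H S F r
    -- A set with fewer than `2 ^ 0` vertices is empty, but `x` lies in `H`.
    grow-ear zero _ small _ = contradiction (x∈p⇒∣p-x∣<∣p∣ x∈H) (≤⇒≯ (≤-trans (s≤s⁻¹ small) z≤n))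
    grow-ear (suc t) d+t≤D small two with Halving.halving-ear H∩S closedH C.connected two
    ... | E , good = grown-extend earEdges (p─q⊆p H _) id cover root
          (≤-trans (+-monoˡ-≤ ∣ rest ∣ (≤-trans (≤-reflexive length-earEdges) (length≤∣listSet∣ unique)))
            (disjoint-size H (listSet ps) rest (ps⊆H ∘ ∈-listSet⁻ ps) (p─q⊆p H _) (λ p q → x∈p─q⇒x∉q H _ q p)))
          touchE
          (λ p → Dist-≤ (≤-trans (m≤m+n (suc d) t) d′≤D) (near₁ (∈-++⁺ˡ p)))
          (λ _ → Anchored-mono id (p─q⊆p H _))
          (grow N (s≤s⁻¹ (≤-trans (<-≤-trans (missing-size (p─q⊆p H _) (ps⊆H p∈ps) (λ q → x∈p─q⇒x∉q H _ q (∈-listSet⁺ p∈ps)))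
                                     (p⊆q⇒∣p∣≤∣q∣ C.⊆R)) size))
            d′≤D trunk fr′)
      where
      open Ear E
      open EarGrowth tr H∩S E
      open Halving H∩S closedH C.connected using (rest⁺; rest⁻)
      d′≤D : suc d + t ≤ D
      d′≤D = ≤-trans (≤-reflexive (sym (+-suc d t))) d+t≤D
      cover : ∀ {x} → x ∈ H → x ∈ rest ⊎ x ∈ S₁
      cover {x} x∈ with ∈ᴸ-dec _≟_ x ps
      ... | yes x∈ps = inj₂ (ps⊆S₁ x∈ps)
      ... | no x∉ps  = inj₁ (rest⁺ E x∈ x∉ps)
      S₁∩rest : ∀ {x} → x ∈ S₁ → x ∉ rest
      S₁∩rest x∈ q with x∈p∪q⁻ S _ x∈
      ... | inj₁ x∈S = H∩S x∈S (p─q⊆p H _ q)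
      ... | inj₂ x∈P = x∈p─q⇒x∉q H _ q x∈P
      touchE : ∀ {e} → e ∈ᴸ earEdges → Touches H e × ¬ Touches rest e
      touchE p with earEdge-ends p
      ... | x , y , j , x∈S₁ , y∈ps = (y , x , Joins-sym j , ps⊆H y∈ps) ,
            λ t → [ S₁∩rest x∈S₁ , S₁∩rest (ps⊆S₁ y∈ps) ]′ (Touches-end t j)
      fr′ : Frontier rest S₁ t
      fr′ = record
        { disjoint = S₁∩rest
        ; closed = λ x~y x∈ → [ cover , inj₂ ∘ S⊆S₁ ]′ (closedH x~y (p─q⊆p H _ x∈))
        ; s∈S = S⊆S₁ s∈S
        -- As `K` is not bad, twice its size is at most that of `H`, which is below `2 ^ suc t`.
        ; bound = λ {K} CK twoK → *-cancelˡ-< 2 ∣ K ∣ (2 ^ t)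
            (≤-<-trans (≮⇒≥ (λ big → good (record { comp = CK ; two = twoK ; big = big }))) small)
        }

    attachment : ∃ λ a → a ∈ S × Neighbour H a
    attachment with exit (whole x s) x∈H (H∩S s∈S)
    ... | y , a , e , _ , j , y∈H , a∉H with closedH (e , j) y∈H
    ...   | inj₁ a∈H = contradiction a∈H a∉H
    ...   | inj₂ a∈S = a , a∈S , y , y∈H , e , j

    -- H hangs at a: forget the trunk and restart from an edge at a.
    restart : ¬ TwoNeighbours H S → (∃ λ a → a ∈ S × Neighbour H a) → Grown H S F r
    restart ¬two (a , a∈S , h , h∈H , e , j) = grown-extend (e ∷ []) (p─q⊆p H _) (λ ()) cover root
      (x∈p⇒∣p-x∣<∣p∣ h∈H)
      (λ { (here refl) → (h , a , j , h∈H) ,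
             λ t → [ S₁∩H′ h∈S₁ , S₁∩H′ a∈S₁ ]′ (Touches-end t j) })
      (λ { (here refl) → nil })
      -- Distances to the new starting edge are of no use for the old `r`; instead all edges
      -- touching `H` are separated at `a`.
      (λ te _ → inj₂ (a , H , hangs , id , te))
      (grow N (s≤s⁻¹ (≤-trans (<-≤-trans (x∈p⇒∣p-x∣<∣p∣ h∈H) (p⊆q⇒∣p∣≤∣q∣ C.⊆R)) size)) ≤-refl trunk fr′)
      where
      H′ S₁ : Subset n
      H′ = H - h
      S₁ = ⁅ a ⁆ ∪ ⁅ h ⁆
      a∈S₁ : a ∈ S₁
      a∈S₁ = x∈p∪q⁺ (inj₁ (x∈⁅x⁆ a))
      h∈S₁ : h ∈ S₁
      h∈S₁ = x∈p∪q⁺ (inj₂ (x∈⁅x⁆ h))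
      S₁⁻ : ∀ {x} → x ∈ S₁ → x ≡ a ⊎ x ≡ h
      S₁⁻ x∈ = [ inj₁ ∘ x∈⁅y⁆⇒x≡y a , inj₂ ∘ x∈⁅y⁆⇒x≡y h ]′ (x∈p∪q⁻ ⁅ a ⁆ ⁅ h ⁆ x∈)
      S₁∩H′ : ∀ {x} → x ∈ S₁ → x ∉ H′
      S₁∩H′ x∈ q with S₁⁻ x∈
      ... | inj₁ refl = H∩S a∈S (p─q⊆p H _ q)
      ... | inj₂ refl = x∈p─q⇒x∉q H _ q (x∈⁅x⁆ h)
      cover : ∀ {x} → x ∈ H → x ∈ H′ ⊎ x ∈ S₁
      cover {x} x∈ with x ≟ h
      ... | yes refl = inj₂ h∈S₁
      ... | no x≢h   = inj₁ (x∈p∧x≢y⇒x∈p-y x∈ x≢h)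
      root : ∀ {x} → x ∈ S₁ → ∃ λ s → s ∈ S × Walk G (_∈ᴸ (e ∷ []) ++ []) x s
      root x∈ with S₁⁻ x∈
      ... | inj₁ refl = a , a∈S , here
      ... | inj₂ refl = a , a∈S , edgeʷ (here refl) j
      only-a : ∀ {y} → y ∈ S → Neighbour H y → y ≡ a
      only-a {y} y∈S ny with y ≟ a
      ... | yes y≡a = y≡a
      ... | no y≢a  = contradiction (twoNeighbours y≢a y∈S a∈S ny (h , h∈H , e , j)) ¬two
      hangs : HangsAt a H
      hangs = H∩S a∈S , λ {e} {x} j x∈ → [ inj₁ , (λ y∈S → inj₂ (only-a y∈S (x , x∈ , e , j))) ]′ (closedH (e , j) x∈)
      to-a : ∀ {x} → x ∈ S₁ → Walk G (_∈ᴸ e ∷ []) x a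
      to-a x∈ with S₁⁻ x∈
      ... | inj₁ refl = here
      ... | inj₂ refl = edgeʷ (here refl) j
      trunk : Trunk S₁ (e ∷ []) e 0
      trunk = record
        { within = λ { (here refl) → joins-inside j h∈S₁ a∈S₁ }
        ; connected = λ p q → to-a p ++ʷ symʷ (to-a q)
        ; near = λ { (here refl) → nil }
        }
      fr′ : Frontier H′ S₁ D
      fr′ = record
        { disjoint = S₁∩H′
        ; closed = λ {x} {y} x~y x∈ → [ cover , (λ y∈S → inj₂ (subst (_∈ S₁) (sym (only-a y∈S (x , p─q⊆p H _ x∈ , x~y))) a∈S₁)) ]′
                     (closedH x~y (p─q⊆p H _ x∈))
        ; s∈S = a∈S₁
        -- The full budget `D` is available again: a component misses `a`, so it has fewer than n
        -- vertices.
        ; bound = λ CK _ → <-≤-trans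
            (<-≤-trans (missing-size ⊆⊤ ∈⊤ (λ a∈K → S₁∩H′ a∈S₁ (Component.⊆R CK a∈K))) (≤-reflexive (∣⊤∣≡n n))) n≤2^D
        }

    grow-component : Dec (TwoNeighbours H S) → Grown H S F r
    grow-component (yes two) = grow-ear t d+t≤D (bound C two) two
    grow-component (no ¬two) = restart ¬two attachment

-- Binary logarithms and the final count.

1≤⌈log₂⌉ : ∀ n → 1 ≤ ⌈log₂ suc (suc n) ⌉
1≤⌈log₂⌉ n = ⌈log₂⌉-mono-≤ {2} {suc (suc n)} (s≤s (s≤s z≤n))

double-≤-2^ : ∀ {n h d} → n ≤ h + h → h ≤ 2 ^ (d ∸ 1) → 1 ≤ d → n ≤ 2 ^ d
double-≤-2^ {d = suc d} n≤ h≤ _ =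
  ≤-trans n≤ (+-mono-≤ h≤ (≤-trans h≤ (≤-reflexive (sym (+-identityʳ (2 ^ d))))))

-- Strong induction along n to ⌈n/2⌉, which lowers the logarithm by one.
n≤2^⌈log₂n⌉ : ∀ n → n ≤ 2 ^ ⌈log₂ n ⌉
n≤2^⌈log₂n⌉ n = go n n ≤-refl
  where
  go : ∀ N n → n ≤ N → n ≤ 2 ^ ⌈log₂ n ⌉
  go _       zero          _   = z≤n
  go _       (suc zero)    _   = s≤s z≤n
  go (suc N) (suc (suc n)) n≤N = double-≤-2^
    (≤-trans (≤-reflexive (sym (⌊n/2⌋+⌈n/2⌉≡n (2 + n)))) (+-monoˡ-≤ ⌈ 2 + n /2⌉ (⌊n/2⌋≤⌈n/2⌉ (2 + n))))
    (subst (λ k → ⌈ 2 + n /2⌉ ≤ 2 ^ k) (⌈log₂⌈n/2⌉⌉≡⌈log₂n⌉∸1 (2 + n))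
      (go N ⌈ 2 + n /2⌉ (≤-trans (s≤s⁻¹ (⌈n/2⌉<n n)) (s≤s⁻¹ n≤N))))
    (1≤⌈log₂⌉ n)

list-labelling : ∀ {m k} (L : List (Fin m)) → length L ≡ k →
                 Σ (Fin k → Fin m) λ l → (∀ i → l i ∈ᴸ L) × (∀ {e} → e ∈ᴸ L → ∃ λ i → l i ≡ e)
list-labelling L refl = lookup L , ∈-lookup , λ p → index p , sym (lookup-index p)

∣⊤-x∣<n : ∀ {n} (x : Fin n) → ∣ full - x ∣ < n
∣⊤-x∣<n {n} x = <-≤-trans (x∈p⇒∣p-x∣<∣p∣ {x = x} {p = full {n}} ∈⊤) (≤-reflexive (∣⊤∣≡n n))

-- The common tree and the complete reconfiguration.

module _ {a m : ℕ} (G : Graph (suc (suc a)) m) {D : ℕ} (n≤2^D : suc (suc a) ≤ 2 ^ D) (1≤D : 1 ≤ D) where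

  private
    n : ℕ
    n = suc (suc a)

  record Target : Set where
    open Exchange G
    field
      t        : Labelling n m
      spans    : Spans t
      near     : ∀ {p q} → Image {n} t p → Image {n} t q → p ≈ᵇ q → Dist (Image {n} t) (D + D) p q

  module _ (whole : Connected G (λ _ → ⊤)) where

    open Growth G whole D n≤2^D

    private
      R : Subset n
      R = full - zero

    size-R : ∣ R ∣ ≤ suc a
    size-R = s≤s⁻¹ (∣⊤-x∣<n zero)

    -- `size` and the edge count of connected graphs leave exactly n - 1 edges. Between edges
    -- related by `_≈ᵇ_` a separation is impossible, so `resolved` yields a distance.
    grown⇒target : ∀ {r} → Grown R ⁅ zero ⁆ [] r → Target
    grown⇒target A = label (list-labelling A.new (≤-antisym (≤-trans A.size size-R)
                       (connected⇒length≥ {G = G} A.new spanning)))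
      where
      module A = Grown A
      plain : ∀ {e} → e ∈ᴸ A.new ++ [] → e ∈ᴸ A.new
      plain = subst (_ ∈ᴸ_) (++-identityʳ A.new)
      to-zero : ∀ x → Walk G (_∈ᴸ A.new) x zero
      to-zero x with x ≟ zero
      ... | yes refl = here
      ... | no x≢ = let s , s∈ , w = A.spans (x∈p∧x≢y⇒x∈p-y ∈⊤ x≢)
                    in subst (Walk G _ x) (x∈⁅y⁆⇒x≡y zero s∈) (mapʷ plain w)
      spanning : Connected G (_∈ᴸ A.new)
      spanning x y = to-zero x ++ʷ symʷ (to-zero y)
      label : (Σ (Labelling n m) λ l → (∀ i → l i ∈ᴸ A.new) × (∀ {e} → e ∈ᴸ A.new → Image {n} l e)) → Target
      label (t , into , onto) = record
        { t = t
        ; spans = λ x y → mapʷ onto (spanning x y)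
        ; near = λ { (i , refl) (j , refl) → close i j (A.resolved (into i) (into j)) }
        }
        where
        close : ∀ i j → Resolved (_∈ᴸ A.new ++ []) (t i) (t j) → t i ≈ᵇ t j → Dist (Image {n} t) (D + D) (t i) (t j)
        close i j (inj₁ x) _ = Dist-mono (onto ∘ plain) x
        close i j (inj₂ (_ , _ , s , inj₁ (te , ¬tf))) eq = contradiction (proj₁ (eq s) te) ¬tf
        close i j (inj₂ (_ , _ , s , inj₂ (¬te , tf))) eq = contradiction (proj₂ (eq s) tf) ¬te

    -- The initial trunk is one vertex without edges. No component can see two covered vertices, so
    -- each begins with a restart.
    target : Fin m → Target
    target r = grown⇒target (grow {t = D} {r = r} (suc a) size-R ≤-refl tr fr)
      where
      fr : Frontier R ⁅ zero ⁆ D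
      fr = record
        { disjoint = λ x∈ q → x∈p─q⇒x∉q full _ q x∈
        ; closed = λ {x} {y} _ _ → case y ≟ zero of λ
            { (yes refl) → inj₂ (x∈⁅x⁆ zero) ; (no y≢) → inj₁ (x∈p∧x≢y⇒x∈p-y ∈⊤ y≢) }
        ; s∈S = x∈⁅x⁆ zero
        ; bound = λ { _ (twoNeighbours a≢b a∈ b∈ _ _) →
            contradiction (trans (x∈⁅y⁆⇒x≡y zero a∈) (sym (x∈⁅y⁆⇒x≡y zero b∈))) a≢b }
        }
      tr : Trunk ⁅ zero ⁆ [] r 0
      tr = record
        { within = λ ()
        ; connected = λ p q → subst₂ (Walk G _) (sym (x∈⁅y⁆⇒x≡y zero p)) (sym (x∈⁅y⁆⇒x≡y zero q)) here
        ; near = λ ()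
        }

  reconfigure-via : Target → (l₁ l₂ : Labelling n m) → IsLabelledSpanningTree G l₁ → IsLabelledSpanningTree G l₂ →
                (∀ i → SameBlock G (l₁ i) (l₂ i)) → Exchange.Reach G (14 * n * D) l₁ l₂
  reconfigure-via target l₁ l₂ (_ , sp₁ , _) (_ , sp₂ , _) same =
    reach-≤ bound (reach-trans A₁.to (reach-trans (reach-sorted near A₂.spans goal₂∈T sortable) A₂.from))
    where
    open Exchange G
    open Target target
    A₁ : Approach t spans l₁ (suc a) (allFin _)
    A₁ = approach t spans sp₁
    A₂ : Approach t spans l₂ (suc a) (allFin _)
    A₂ = approach t spans sp₂
    module A₁ = Approach A₁
    module A₂ = Approach A₂
    T⊆ : ∀ {l} (A : Approach t spans l (suc a) (allFin _)) → ∀ {e} → Image {n} t e → Image {n} (Approach.goal A) e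
    T⊆ A (j , refl) = Approach.hits A (∈-allFin j)
    -- A label of goal outside t would be spare.
    ⊆T : ∀ {l} (A : Approach t spans l (suc a) (allFin _)) → ∀ i → Image {n} t (Approach.goal A i)
    ⊆T A i with any? (λ j → t j ≟ Approach.goal A i)
    ... | yes p = p
    ... | no ¬p = contradiction
      (λ u v → mapʷ (λ p → let h , eq = T⊆ A p in
                           h , (λ { refl → ¬p (subst (Image {n} t) (sym eq) p) }) , eq) (spans u v))
      (no-spare-label (Approach.goal A) i)
    goal₂∈T = ⊆T A₂
    sortable : Sortable near A₂.spans goal₂∈T A₁.goal
    sortable = record
      { spans = A₁.spans
      ; T⊆ = T⊆ A₁
      ; ⊆T = ⊆T A₁
      ; close = λ i → ≈ᵇ-trans (≈ᵇ-sym (A₁.close i)) (≈ᵇ-trans (SameBlock⇒≈ᵇ (same i)) (A₂.close i))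
      }
    r : ℕ
    r = suc a
    r≤rD : r ≤ r * D
    r≤rD = ≤-trans (≤-reflexive (sym (*-identityʳ r))) (*-monoʳ-≤ r 1≤D)
    -- Sorting takes 12 D steps per label and the two approaches one each; `1≤D` turns these into D
    -- each, hence 14.
    bound : r + (r * (6 * (D + D)) + r) ≤ 14 * n * D
    bound = begin
      r + (r * (6 * (D + D)) + r)         ≤⟨ +-mono-≤ r≤rD (+-monoʳ-≤ (r * (6 * (D + D))) r≤rD) ⟩
      r * D + (r * (6 * (D + D)) + r * D) ≡⟨ solve 2 (λ k D → k :* D :+ (k :* (con 6 :* (D :+ D)) :+ k :* D) := con 14 :* k :* D) refl r D ⟩
      14 * r * D                          ≤⟨ *-monoˡ-≤ D (*-monoʳ-≤ 14 (n≤1+n r)) ⟩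
      14 * n * D                          ∎
      where
      open ≤-Reasoning
      open +-*-Solver

  reconfigure : (l₁ l₂ : Labelling n m) → IsLabelledSpanningTree G l₁ → IsLabelledSpanningTree G l₂ →
                (∀ i → SameBlock G (l₁ i) (l₂ i)) → Exchange.Reach G (14 * n * D) l₁ l₂
  reconfigure l₁ l₂ t₁ = reconfigure-via (target (λ u v → Walks.mapʷ G (λ _ → tt) (proj₁ (proj₂ t₁) u v)) (l₁ zero)) l₁ l₂ t₁

theorem2 : Σ ℕ λ C → ∀ (n m : ℕ) (G : Graph n m) → Simple G
    → (l₁ l₂ : Labelling n m)
    → IsLabelledSpanningTree G l₁ → IsLabelledSpanningTree G l₂
    → (∀ i → SameBlock G (l₁ i) (l₂ i))
    → ∃ λ k → k ≤ C * n * ⌈log₂ n ⌉ × Reconf G k l₁ l₂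
theorem2 = 14 , λ
  -- For n at most 1 there are no labels, so zero steps suffice.
  { zero          m G _ l₁ l₂ _  _  _    → 0 , z≤n , done λ ()
  ; (suc zero)    m G _ l₁ l₂ _  _  _    → 0 , z≤n , done λ ()
  ; (suc (suc a)) m G _ l₁ l₂ t₁ t₂ same → reconfigure G (n≤2^⌈log₂n⌉ (suc (suc a))) (1≤⌈log₂⌉ a) l₁ l₂ t₁ t₂ same
  }
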